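{- Let $P$ be a permutation simply typed, input-linear program with input selectability and let $Q$ be a permutation simply typed query. Let $p$ be a predicate whose input positions are all bound and of constant type. Then in any delay-respecting derivation of $P\cup\{Q\}$, an atom using $p$ is selected only when its input arguments are correctly typed (i.e. each input argument belongs to the type associated with its position).
   Context: Basics. A query is a finite sequence of atoms; a clause is $h\leftarrow B$ with $h$ an atom and $B$ a query. Built-in predicates are regarded as defined by possibly infinitely many fact clauses belonging to the program. Every predicate has a fixed mode, i.e. each argument position is either input or output; $p(\mathbf s,\mathbf t)$ denotes an atom with $\mathbf s$ (resp. $\mathbf t$) the vector of terms filling the input (resp. output) positions. In clause heads $p(\mathbf t_0,\mathbf s_{n+1})$, $\mathbf t_0$ is the input and $\mathbf s_{n+1}$ the output. A syntactic object is linear if each variable occurs in it at most once. A clause is input-linear if the vector of input terms of its head is linear; a program is input-linear if all its clauses are and it does not use the equality predicate $=$ with both arguments input. A flat term is a variable or a term $f(x_1,\dots,x_n)$, $n\ge 0$, with distinct variables $x_i$. A permutation $\pi$ on $\{1,\dots,n\}$ is extended by $\pi(i)=i$ outside $\{1,\dots,n\}$. Types. A type is a non-empty set of terms closed under instantiation. The variable type is the type of all terms; any other type is a non-variable type. A constant type is a type consisting only of (possibly infinitely many) constants. Each argument position of each predicate has an associated type. $t:T$ means $t\in T$ (componentwise for vectors); $\models \varphi\Rightarrow \mathbf t:\mathbf T$ means that the implication holds after applying any substitution to all terms. A term is type-consistent (in a position of type $T$) if some instance of it is in $T$. Nicely moded. $Q=p_1(\mathbf s_1,\mathbf t_1),\dots,p_n(\mathbf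 s_n,\mathbf t_n)$ is $\pi$-nicely moded if $\mathbf t_1,\dots,\mathbf t_n$ is linear and for all $i$, $vars(\mathbf s_i)\cap\bigcup_{\pi(i)\le\pi(j)\le n}vars(\mathbf t_j)=\emptyset$. A clause $p(\mathbf t_0,\mathbf s_{n+1})\leftarrow Q$ is $\pi$-nicely moded if $Q$ is and $vars(\mathbf t_0)\cap\bigcup_{j=1}^n vars(\mathbf t_j)=\emptyset$. Well typed. With $p_i(\mathbf S_i,\mathbf T_i)$ the type of $p_i$, $Q$ is $\pi$-well typed if for all $i\in\{1,\dots,n\}$, $\models(\bigwedge_{1\le\pi(j)<\pi(i)}\mathbf t_j:\mathbf T_j)\Rightarrow\mathbf s_i:\mathbf S_i$. A clause $p(\mathbf t_0,\mathbf s_{n+1})\leftarrow Q$, with $p(\mathbf T_0,\mathbf S_{n+1})$ the type of $p$, is $\pi$-well typed if for all $i\in\{1,\dots,n+1\}$, $\models(\bigwedge_{0\le\pi(j)<\pi(i)}\mathbf t_j:\mathbf T_j)\Rightarrow\mathbf s_i:\mathbf S_i$. Simply typed. $Q$ is $\pi$-simply typed if it is $\pi$-nicely moded and $\pi$-well typed and $\mathbf t_1,\dots,\mathbf t_n$ is a vector of variables. A clause $p(\mathbf t_0,\mathbf s_{n+1})\leftarrow Q$ is $\pi$-simply typed if it is $\pi$-nicely moded and $\pi$-well typed, $\mathbf t_1,\dots,\mathbf t_n$ is a vector of variables, and $\mathbf t_0$ is a vector of flat type-consistent terms that has a variable in each position of variable type. "Permutation simply typed" means $\pi$-simply typed for some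 $\pi$ (for each clause, for programs). Bound/free. An input position of a predicate $p$ is bound (in $P$) if some clause head $p(\dots)$ in $P$ has a non-variable term there; an output position is bound if some body atom $p(\dots)$ in $P$ has a non-variable term there; otherwise it is free. Derivations. A program consists of clauses and, for each predicate $p/n$, a block declaration: a (possibly empty) set of atoms $p(b_1,\dots,b_n)$ with $b_i\in\{?,-\}$. An atom $p(t_1,\dots,t_n)$ is blocked if for some $p(b_1,\dots,b_n)$ in the declaration, $t_i$ is a variable for all $i$ with $b_i=-$; otherwise it is selectable. In a derivation step a query $Q_1,a,Q_2$ is replaced by $(Q_1,B,Q_2)\theta$, where $h\leftarrow B$ is a variant, renamed apart, of a program clause and $\theta$ is a most general unifier of the selected atom $a$ and $h$. A derivation of $P\cup\{Q\}$ is a sequence of such steps starting at $Q$; it is delay-respecting if the selected atom is always selectable. Input selectability. $P$ has input selectability if every atom (using a predicate of $P$) that has variables in all free output positions is selectable in $P$ (1) only if it is non-variable in all bound input positions, and (2) if it is non-variable in all input positions of non-variable type. -}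

module Defs where

open import Data.Fin as Fin using (Fin)
open import Data.Fin.Permutation using (Permutation′; _⟨$⟩ʳ_)
open import Data.List as List using (List; []; _∷_; _++_; concatMap; allFin; filter; length)
open import Data.List.Membership.Propositional using (_∈_)
open import Data.List.Relation.Binary.Disjoint.Propositional using (Disjoint)
open import Data.List.Relation.Unary.Unique.Propositional using (Unique)
open import Data.Maybe using (Maybe; just; nothing)
open import Data.Nat using (ℕ; suc; _<_)
open import Data.Product using (Σ; ∃; _×_)
open import Data.Sum using (_⊎_)
open import Data.Unit using (⊤)
open import Data.Vec as Vec using (Vec; []; _∷_; lookup)
open import Data.Vec.Relation.Unary.Unique.Propositional using () renaming (Unique to Uniqueᵛ)
open import Function.Bundles using (_↔_; Inverse)
open import Relation.Binary.PropositionalEquality using (_≡_; refl)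
open import Relation.Nullary using (¬_; Dec; yes; no)

Var : Set
Var = ℕ

data Mode : Set where
  input output : Mode

_≟ᵐ_ : (m n : Mode) → Dec (m ≡ n)
input  ≟ᵐ input  = yes refl
input  ≟ᵐ output = no λ ()
output ≟ᵐ input  = no λ ()
output ≟ᵐ output = yes refl

-- The entries ? and - of a block declaration p(b₁,…,bₙ).
data Mark : Set where
  question dash : Mark

record Signature : Set₁ where
  field
    Fun   : Set
    ar    : Fun → ℕ
    Pred  : Set
    arity : Pred → ℕ
    mode  : (p : Pred) → Fin (arity p) → Mode
    -- The equality predicate.  Each predicate symbol has one fixed mode, so
    -- differently moded uses of = are different symbols, all in IsEquality.
    IsEquality : Pred → Set
    equality-binary : ∀ {p} → IsEquality p → arity p ≡ 2

module Syntax (S : Signature) where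
  open Signature S public

  data Term : Set where
    var : Var → Term
    fn  : (f : Fun) → Vec Term (ar f) → Term

  data IsVar : Term → Set where
    is-var : ∀ x → IsVar (var x)

  NonVar : Term → Set
  NonVar t = ¬ IsVar t

  data IsConstant : Term → Set where
    is-constant : ∀ {f ts} → ar f ≡ 0 → IsConstant (fn f ts)

  data Flat : Term → Set where
    flat-var : ∀ x → Flat (var x)
    flat-fn  : ∀ f (xs : Vec Var (ar f)) → Uniqueᵛ xs → Flat (fn f (Vec.map var xs))

  infix 8 _·_
  record Atom : Set where
    constructor _·_
    field
      pred : Pred
      args : Vec Term (arity pred)
  open Atom public

  Query : Set
  Query = List Atom

  infix 4 _⟵_
  record Clause : Set where
    constructor _⟵_
    field
      head : Atom
      body : Query
  open Clause public

  positions : Mode → (p : Pred) → List (Fin (arity p))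
  positions m p = filter (λ i → mode p i ≟ᵐ m) (allFin (arity p))

  inputs outputs : Atom → List Term
  inputs  (p · ts) = List.map (lookup ts) (positions input p)
  outputs (p · ts) = List.map (lookup ts) (positions output p)

  -- Lists of variable occurrences, with repetitions.
  mutual
    vars : Term → List Var
    vars (var x)   = x ∷ []
    vars (fn f ts) = varsᵛ ts

    varsᵛ : ∀ {n} → Vec Term n → List Var
    varsᵛ []       = []
    varsᵛ (t ∷ ts) = vars t ++ varsᵛ ts

  varsˡ : List Term → List Var
  varsˡ = concatMap vars

  varsᵃ : Atom → List Var
  varsᵃ a = varsᵛ (args a)

  varsᑫ : Query → List Var
  varsᑫ = concatMap varsᵃ

  varsᶜ : Clause → List Var
  varsᶜ c = varsᵃ (head c) ++ varsᑫ (body c)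

  Linear : List Term → Set
  Linear ts = Unique (varsˡ ts)

  -- No finiteness of the domain is imposed.
  Subst : Set
  Subst = Var → Term

  infixl 9 _[_] _[_]ᵛ _[_]ᵃ _[_]ᑫ _[_]ᶜ
  mutual
    _[_] : Term → Subst → Term
    var x   [ σ ] = σ x
    fn f ts [ σ ] = fn f (ts [ σ ]ᵛ)

    _[_]ᵛ : ∀ {n} → Vec Term n → Subst → Vec Term n
    []       [ σ ]ᵛ = []
    (t ∷ ts) [ σ ]ᵛ = t [ σ ] ∷ ts [ σ ]ᵛ

  _[_]ᵃ : Atom → Subst → Atom
  (p · ts) [ σ ]ᵃ = p · (ts [ σ ]ᵛ)

  _[_]ᑫ : Query → Subst → Query
  Q [ σ ]ᑫ = List.map (_[ σ ]ᵃ) Q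

  _[_]ᶜ : Clause → Subst → Clause
  (h ⟵ B) [ σ ]ᶜ = h [ σ ]ᵃ ⟵ B [ σ ]ᑫ

  Variant : Clause → Clause → Set
  Variant c c′ = Σ (Var ↔ Var) λ ρ → c′ ≡ c [ (λ x → var (Inverse.to ρ x)) ]ᶜ

  Unifier : Atom → Atom → Subst → Set
  Unifier a b σ = a [ σ ]ᵃ ≡ b [ σ ]ᵃ

  MGU : Atom → Atom → Subst → Set
  MGU a b θ = Unifier a b θ
            × (∀ σ → Unifier a b σ → Σ Subst λ δ → ∀ x → σ x ≡ θ x [ δ ])

  -- The clauses form an arbitrary, possibly infinite set, so that the facts
  -- defining built-in predicates can belong to it.
  record Program : Set₁ where
    field
      clauses : Clause → Set
      block   : (p : Pred) → List (Vec Mark (arity p))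
  open Program public

  PredicateOf : Program → Pred → Set
  PredicateOf P p = ∃ λ c → clauses P c × ∃ λ ts → head c ≡ p · ts ⊎ p · ts ∈ body c

  InputLinearClause : Clause → Set
  InputLinearClause c = Linear (inputs (head c))

  InputLinear : Program → Set
  InputLinear P =
      (∀ c → clauses P c → InputLinearClause c)
    × (∀ p → IsEquality p → (∀ i → mode p i ≡ input) →
       ∀ c → clauses P c → ∀ ts → ¬ (p · ts ∈ body c))

  data Bound (P : Program) (p : Pred) (i : Fin (arity p)) : Set where
    bound-input  : mode p i ≡ input →
                   ∀ c → clauses P c → ∀ ts → head c ≡ p · ts →
                   NonVar (lookup ts i) → Bound P p i
    bound-output : mode p i ≡ output →
                   ∀ c → clauses P c → ∀ ts → p · ts ∈ body c →
                   NonVar (lookup ts i) → Bound P p i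

  Free : (P : Program) (p : Pred) → Fin (arity p) → Set
  Free P p i = ¬ Bound P p i

  Blocked : Program → Atom → Set
  Blocked P (p · ts) =
    ∃ λ b → b ∈ block P p × (∀ i → lookup b i ≡ dash → IsVar (lookup ts i))

  Selectable : Program → Atom → Set
  Selectable P a = ¬ Blocked P a

  record Selection (Q : Query) : Set where
    field
      before   : Query
      selected : Atom
      after    : Query
      split    : Q ≡ before ++ selected ∷ after

  record Step (P : Program) (Q Q′ : Query) : Set where
    field
      selection : Selection Q
    open Selection selection public
    field
      source    : Clause
      source∈P  : clauses P source
      clause    : Clause
      variant   : Variant source clause
      apart     : Disjoint (varsᶜ clause) (varsᑫ Q)
      θ         : Subst
      mgu       : MGU selected (head clause) θ
      resolvent : Q′ ≡ (before ++ body clause ++ after) [ θ ]ᑫ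

  -- A number of steps: just n, or infinitely many.
  Length : Set
  Length = Maybe ℕ

  _≺_ : ℕ → Length → Set
  k ≺ just n  = k < n
  k ≺ nothing = ⊤

  -- Values of query beyond the length are irrelevant.  In the last query of a
  -- finite derivation an atom may have been selected without a further step
  -- (as when it unifies with no clause head); this is recorded in final.
  record Derivation (P : Program) (Q : Query) : Set where
    field
      len   : Length
      query : ℕ → Query
      start : query 0 ≡ Q
      step  : ∀ k → k ≺ len → Step P (query k) (query (suc k))
      final : ∀ n → len ≡ just n → Maybe (Selection (query n))

  module _ {P : Program} {Q : Query} (D : Derivation P Q) where
    open Derivation D

    data Selected : Atom → Set where
      in-step : ∀ k (k≺ : k ≺ len) → Selected (Step.selected (step k k≺))
      at-end  : ∀ n (e : len ≡ just n) s → final n e ≡ just s →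
                Selected (Selection.selected s)

    DelayRespecting : Set
    DelayRespecting = ∀ a → Selected a → Selectable P a

  record Type : Set₁ where
    field
      _∋_       : Term → Set
      non-empty : ∃ λ t → _∋_ t
      closed    : ∀ t σ → _∋_ t → _∋_ (t [ σ ])
  open Type public using (_∋_)

  VariableType : Type → Set
  VariableType T = ∀ t → T ∋ t

  NonVariableType : Type → Set
  NonVariableType T = ¬ VariableType T

  ConstantType : Type → Set
  ConstantType T = ∀ t → T ∋ t → IsConstant t

  TypeConsistent : Type → Term → Set
  TypeConsistent T t = Σ Subst λ σ → T ∋ (t [ σ ])

  Typing : Set₁
  Typing = (p : Pred) → Fin (arity p) → Type

  -- Qᵢ = pᵢ(sᵢ,tᵢ) is List.lookup Q i.
  NicelyModed : (Q : Query) → Permutation′ (length Q) → Set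
  NicelyModed Q π =
      Linear (concatMap outputs Q)
    × (∀ i j → (π ⟨$⟩ʳ i) Fin.≤ (π ⟨$⟩ʳ j) →
       Disjoint (varsˡ (inputs (List.lookup Q i))) (varsˡ (outputs (List.lookup Q j))))

  NicelyModedClause : (c : Clause) → Permutation′ (length (body c)) → Set
  NicelyModedClause c π =
      NicelyModed (body c) π
    × (∀ j → Disjoint (varsˡ (inputs (head c))) (varsˡ (outputs (List.lookup (body c) j))))

  OutputsVariables : Query → Set
  OutputsVariables Q = ∀ t → t ∈ concatMap outputs Q → IsVar t

  module Typed (τ : Typing) where

    ArgumentsTyped : Mode → Atom → Set
    ArgumentsTyped m (p · ts) = ∀ i → mode p i ≡ m → τ p i ∋ lookup ts i

    InputsTyped OutputsTyped : Atom → Set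
    InputsTyped  = ArgumentsTyped input
    OutputsTyped = ArgumentsTyped output

    WellTyped : (Q : Query) → Permutation′ (length Q) → Set
    WellTyped Q π =
      ∀ i (σ : Subst) →
      (∀ j → (π ⟨$⟩ʳ j) Fin.< (π ⟨$⟩ʳ i) → OutputsTyped (List.lookup Q j [ σ ]ᵃ)) →
      InputsTyped (List.lookup Q i [ σ ]ᵃ)

    -- The indices 0 and n + 1, fixed by π, stand for the input and the output
    -- of the head; the second component is the condition for i = n + 1.
    WellTypedClause : (c : Clause) → Permutation′ (length (body c)) → Set
    WellTypedClause (h ⟵ B) π =
        (∀ i (σ : Subst) →
         InputsTyped (h [ σ ]ᵃ) →
         (∀ j → (π ⟨$⟩ʳ j) Fin.< (π ⟨$⟩ʳ i) → OutputsTyped (List.lookup B j [ σ ]ᵃ)) →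
         InputsTyped (List.lookup B i [ σ ]ᵃ))
      × (∀ (σ : Subst) →
         InputsTyped (h [ σ ]ᵃ) →
         (∀ j → OutputsTyped (List.lookup B j [ σ ]ᵃ)) →
         OutputsTyped (h [ σ ]ᵃ))

    SimplyTyped : (Q : Query) → Permutation′ (length Q) → Set
    SimplyTyped Q π = NicelyModed Q π × WellTyped Q π × OutputsVariables Q

    SimplyTypedHead : Atom → Set
    SimplyTypedHead (p · ts) =
      ∀ i → mode p i ≡ input →
        Flat (lookup ts i)
      × TypeConsistent (τ p i) (lookup ts i)
      × (VariableType (τ p i) → IsVar (lookup ts i))

    SimplyTypedClause : (c : Clause) → Permutation′ (length (body c)) → Set
    SimplyTypedClause c π =
        NicelyModedClause c π
      × WellTypedClause c π
      × OutputsVariables (body c)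
      × SimplyTypedHead (head c)

    PermutationSimplyTypedQuery : Query → Set
    PermutationSimplyTypedQuery Q = ∃ λ π → SimplyTyped Q π

    PermutationSimplyTyped : Program → Set
    PermutationSimplyTyped P = ∀ c → clauses P c → ∃ λ π → SimplyTypedClause c π

    InputSelectability : Program → Set
    InputSelectability P =
      ∀ p → PredicateOf P p → ∀ ts →
      (∀ i → mode p i ≡ output → Free P p i → IsVar (lookup ts i)) →
        (Selectable P (p · ts) →
         ∀ i → mode p i ≡ input → Bound P p i → NonVar (lookup ts i))
      × ((∀ i → mode p i ≡ input → NonVariableType (τ p i) → NonVar (lookup ts i)) →
         Selectable P (p · ts))

{-# OPTIONS --safe #-}
module Submission where

-- Arranging a permutation simply typed query in the order of its permutation
-- makes it simply typed from left to right, and this property is preserved by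
-- every step of a delay-respecting derivation: the selected atom is
-- non-variable in its bound input positions, so the flat linear inputs of the
-- clause head match it one-way, its output variables are then bound to the
-- outputs of the head, and the body, arranged in its own order, can take the
-- place of the selected atom.  Any other most general unifier differs from this
-- one by a renaming.
--
-- The output variables of such a query are distinct, so some instance of the
-- query has correctly typed outputs, and hence correctly typed inputs.  If an
-- input position has constant type, the argument of that instance is a
-- constant; a non-variable argument with a constant instance is that constant.

open import Defs
open import Data.Fin as Fin using (Fin)
open import Data.Fin.Permutation using (Permutation′; _⟨$⟩ʳ_; _⟨$⟩ˡ_; inverseˡ; inverseʳ)
import Data.Fin.Properties as Fin
open import Data.List as List using (List; []; _∷_; _++_; concatMap; allFin; length)
open import Data.List.Membership.Propositional using (_∈_; _∉_; find)
open import Data.List.Membership.Propositional.Properties using (∈-++⁺ˡ; ∈-++⁺ʳ; ∈-++⁻; ∈-map⁺; ∈-map⁻; ∈-filter⁺; ∈-filter⁻; ∈-allFin; ∈-concatMap⁺; ∈-concatMap⁻; ∈-∃++; ∈-tabulate⁺; ∈-lookup)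
open import Data.List.Membership.Propositional.Properties.WithK using (unique∧set⇒bag)
import Data.List.Properties as List
open import Data.List.Relation.Binary.BagAndSetEquality using (∼bag⇒↭)
open import Data.List.Relation.Binary.Disjoint.Propositional using (Disjoint)
open import Data.List.Relation.Binary.Permutation.Propositional using (_↭_; ↭-sym; ↭-trans; ↭-reflexive; ↭⇒↭ₛ)
import Data.List.Relation.Binary.Permutation.Propositional.Properties as ↭
import Data.List.Relation.Binary.Permutation.Setoid.Properties as ↭ₛ
open import Data.List.Relation.Unary.All as All using (All; []; _∷_)
import Data.List.Relation.Unary.All.Properties as All
open import Data.List.Relation.Unary.AllPairs as AllPairs using (AllPairs; []; _∷_)
import Data.List.Relation.Unary.AllPairs.Properties as AllPairs
open import Data.List.Relation.Unary.Any as Any using (Any; here; there)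
open import Data.List.Relation.Unary.Unique.Propositional using (Unique)
import Data.List.Relation.Unary.Unique.Propositional.Properties as Unique
open import Data.Maybe using (just; nothing)
open import Data.Nat as ℕ using (ℕ; zero; suc)
import Data.Nat.Properties as ℕ
open import Data.Product using (∃; _×_; _,_; proj₁; proj₂)
open import Data.Sum using (_⊎_; inj₁; inj₂; [_,_]′)
open import Data.Unit using (⊤; tt)
open import Data.Vec as Vec using (Vec; []; _∷_; lookup)
import Data.Vec.Properties as Vec
import Data.Vec.Relation.Unary.Unique.Propositional.Properties as Uniqueᵛ
open import Function using (_∘_; id; mk⇔)
open import Function.Bundles using (_↔_; Inverse)
open import Relation.Binary.PropositionalEquality using (_≡_; refl; sym; trans; cong; cong₂; subst; subst₂; resp₂; setoid; module ≡-Reasoning)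
open import Relation.Nullary using (yes; no; contradiction)

-- Lists of pairwise related elements, and indices sorted by a permutation.

AllPairs-++⁻ : ∀ {A : Set} {R : A → A → Set} xs {ys} → AllPairs R (xs ++ ys) →
               AllPairs R xs × AllPairs R ys × All (λ x → All (R x) ys) xs
AllPairs-++⁻ []       Rys = [] , Rys , []
AllPairs-++⁻ (x ∷ xs) (Rx ∷ Rxs) =
  let Rxs′ , Rys , Rxys = AllPairs-++⁻ xs Rxs
  in  All.++⁻ˡ xs Rx ∷ Rxs′ , Rys , All.++⁻ʳ xs Rx ∷ Rxys

AllPairs-map∈ : ∀ {A : Set} {R T : A → A → Set} {xs} →
                (∀ {x y} → x ∈ xs → y ∈ xs → R x y → T x y) →
                AllPairs R xs → AllPairs T xs
AllPairs-map∈ f []         = []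
AllPairs-map∈ f (Rx ∷ Rxs) =
  All.tabulate (λ y∈ → f (here refl) (there y∈) (All.lookup Rx y∈)) ∷
  AllPairs-map∈ (λ x∈ y∈ → f (there x∈) (there y∈)) Rxs

Unique-++⁻ : ∀ {A : Set} (xs : List A) {ys} → Unique (xs ++ ys) →
             Unique xs × Unique ys × Disjoint xs ys
Unique-++⁻ xs u =
  let u₁ , u₂ , d = AllPairs-++⁻ xs u
  in  u₁ , u₂ , λ (x∈ , y∈) → All.lookup (All.lookup d x∈) y∈ refl

-- Entry `k` is the index that `π` sends to `k`, which is why the inverse of `π` is tabulated.
ranked : ∀ {n} → Permutation′ n → List (Fin n)
ranked π = List.tabulate (π ⟨$⟩ˡ_)

∈-ranked : ∀ {n} (π : Permutation′ n) i → i ∈ ranked π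
∈-ranked π i = subst (_∈ ranked π) (inverseˡ π) (∈-tabulate⁺ (π ⟨$⟩ʳ i))

ranked-increasing : ∀ {n} (π : Permutation′ n) →
                    AllPairs (λ i j → (π ⟨$⟩ʳ i) Fin.< (π ⟨$⟩ʳ j)) (ranked π)
ranked-increasing π = AllPairs.tabulate⁺-< λ {i} {j} i<j →
  subst (λ k → k Fin.< (π ⟨$⟩ʳ (π ⟨$⟩ˡ j))) (sym (inverseʳ π))
    (subst (i Fin.<_) (sym (inverseʳ π)) i<j)

-- Both lists are free of duplicates and contain every index, so they agree as bags.
ranked-↭ : ∀ {n} (π : Permutation′ n) → ranked π ↭ allFin n
ranked-↭ π = ∼bag⇒↭ (unique∧set⇒bag
  (Unique.tabulate⁺ λ {i} {j} eq →
    trans (sym (inverseʳ π)) (trans (cong (π ⟨$⟩ʳ_) eq) (inverseʳ π)))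
  (Unique.allFin⁺ _)
  (mk⇔ (λ _ → ∈-allFin _) (λ _ → ∈-ranked π _)))

-- Substitutions, renamings and the variables of atoms.

module Substitutions (S : Signature) where
  open Syntax S

  infixr 9 _⨾_
  _⨾_ : Subst → Subst → Subst
  (σ ⨾ τ) x = σ x [ τ ]

  mutual
    []-⨾ : ∀ t σ τ → t [ σ ] [ τ ] ≡ t [ σ ⨾ τ ]
    []-⨾ (var x)   σ τ = refl
    []-⨾ (fn f ts) σ τ = cong (fn f) ([]ᵛ-⨾ ts σ τ)

    []ᵛ-⨾ : ∀ {n} (ts : Vec Term n) σ τ → ts [ σ ]ᵛ [ τ ]ᵛ ≡ ts [ σ ⨾ τ ]ᵛ
    []ᵛ-⨾ []       σ τ = refl
    []ᵛ-⨾ (t ∷ ts) σ τ = cong₂ _∷_ ([]-⨾ t σ τ) ([]ᵛ-⨾ ts σ τ)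

  mutual
    []-var : ∀ t → t [ var ] ≡ t
    []-var (var x)   = refl
    []-var (fn f ts) = cong (fn f) ([]ᵛ-var ts)

    []ᵛ-var : ∀ {n} (ts : Vec Term n) → ts [ var ]ᵛ ≡ ts
    []ᵛ-var []       = refl
    []ᵛ-var (t ∷ ts) = cong₂ _∷_ ([]-var t) ([]ᵛ-var ts)

  mutual
    []-cong : ∀ t {σ τ} → (∀ {x} → x ∈ vars t → σ x ≡ τ x) → t [ σ ] ≡ t [ τ ]
    []-cong (var x)   eq = eq (here refl)
    []-cong (fn f ts) eq = cong (fn f) ([]ᵛ-cong ts eq)

    []ᵛ-cong : ∀ {n} (ts : Vec Term n) {σ τ} →
               (∀ {x} → x ∈ varsᵛ ts → σ x ≡ τ x) → ts [ σ ]ᵛ ≡ ts [ τ ]ᵛ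
    []ᵛ-cong []       eq = refl
    []ᵛ-cong (t ∷ ts) eq =
      cong₂ _∷_ ([]-cong t (eq ∘ ∈-++⁺ˡ)) ([]ᵛ-cong ts (eq ∘ ∈-++⁺ʳ (vars t)))

  fn-injectiveʳ : ∀ {f ts us} → fn f ts ≡ fn f us → ts ≡ us
  fn-injectiveʳ refl = refl

  mutual
    -- This later turns an equation saying that a whole term is fixed into one for each of its
    -- variables.
    []-cong⁻ : ∀ t {σ τ} → t [ σ ] ≡ t [ τ ] → ∀ {x} → x ∈ vars t → σ x ≡ τ x
    []-cong⁻ (var x)   eq (here refl) = eq
    []-cong⁻ (fn f ts) eq x∈          = []ᵛ-cong⁻ ts (fn-injectiveʳ eq) x∈

    []ᵛ-cong⁻ : ∀ {n} (ts : Vec Term n) {σ τ} → ts [ σ ]ᵛ ≡ ts [ τ ]ᵛ →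
                ∀ {x} → x ∈ varsᵛ ts → σ x ≡ τ x
    []ᵛ-cong⁻ (t ∷ ts) eq x∈ =
      [ []-cong⁻ t (Vec.∷-injectiveˡ eq) , []ᵛ-cong⁻ ts (Vec.∷-injectiveʳ eq) ]′ (∈-++⁻ (vars t) x∈)

  mutual
    vars-[]⁻ : ∀ t σ {x} → x ∈ vars (t [ σ ]) → ∃ λ y → y ∈ vars t × x ∈ vars (σ y)
    vars-[]⁻ (var y)   σ x∈ = y , here refl , x∈
    vars-[]⁻ (fn f ts) σ x∈ = varsᵛ-[]⁻ ts σ x∈

    varsᵛ-[]⁻ : ∀ {n} (ts : Vec Term n) σ {x} →
                x ∈ varsᵛ (ts [ σ ]ᵛ) → ∃ λ y → y ∈ varsᵛ ts × x ∈ vars (σ y)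
    varsᵛ-[]⁻ (t ∷ ts) σ x∈ with ∈-++⁻ (vars (t [ σ ])) x∈
    ... | inj₁ x∈t  = let y , y∈ , x∈σy = vars-[]⁻ t σ x∈t    in y , ∈-++⁺ˡ y∈ , x∈σy
    ... | inj₂ x∈ts = let y , y∈ , x∈σy = varsᵛ-[]⁻ ts σ x∈ts in y , ∈-++⁺ʳ (vars t) y∈ , x∈σy

  -- Injectivity is expressed by a left inverse: where one `l` serves a set of variables, `σ` sends
  -- them to distinct variables. The condition is local because two most general unifiers are
  -- related by a renaming only on the variables that matter.
  Renames : Subst → (Var → Var) → Var → Set
  Renames σ l x = ∃ λ y → σ x ≡ var y × l y ≡ x

  mutual
    -- The left inverse restores the list of occurrences itself, with order and multiplicity.
    -- Uniqueness and disjointness of the original variables therefore pass to the instance.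
    vars-rename : ∀ t {σ l} → (∀ {x} → x ∈ vars t → Renames σ l x) →
                  List.map l (vars (t [ σ ])) ≡ vars t
    vars-rename (var x)   {l = l} r =
      let y , σx≡y , ly≡x = r (here refl)
      in  trans (cong (List.map l ∘ vars) σx≡y) (cong (_∷ []) ly≡x)
    vars-rename (fn f ts) r = varsᵛ-rename ts r

    varsᵛ-rename : ∀ {n} (ts : Vec Term n) {σ l} → (∀ {x} → x ∈ varsᵛ ts → Renames σ l x) →
                   List.map l (varsᵛ (ts [ σ ]ᵛ)) ≡ varsᵛ ts
    varsᵛ-rename []       r = refl
    varsᵛ-rename (t ∷ ts) {σ} {l} r = trans (List.map-++ l (vars (t [ σ ])) _)
      (cong₂ _++_ (vars-rename t (r ∘ ∈-++⁺ˡ)) (varsᵛ-rename ts (r ∘ ∈-++⁺ʳ (vars t))))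

  -- The value 0 is arbitrary: `name` matters only on terms that are variables.
  name : Term → Var
  name (var x)  = x
  name (fn _ _) = 0

  -- Only a variable can have a variable as an instance, so a substitution `δ` that undoes `σ` at
  -- `x` yields a left inverse on variables.
  renames : ∀ {σ δ x} → σ x [ δ ] ≡ var x → Renames σ (name ∘ δ) x
  renames {σ} {x = x} eq with σ x
  ... | var y = y , refl , cong name eq

  IsVar-rename : ∀ {σ l t} → (∀ {x} → x ∈ vars t → Renames σ l x) → IsVar t → IsVar (t [ σ ])
  IsVar-rename r (is-var x) with y , σx≡y , _ ← r (here refl) = subst IsVar (sym σx≡y) (is-var y)

  varsˡ-[]⁻ : ∀ ts σ {x} → x ∈ varsˡ (List.map (_[ σ ]) ts) → ∃ λ y → y ∈ varsˡ ts × x ∈ vars (σ y)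
  varsˡ-[]⁻ (t ∷ ts) σ x∈ with ∈-++⁻ (vars (t [ σ ])) x∈
  ... | inj₁ x∈t  = let y , y∈ , x∈σy = vars-[]⁻ t σ x∈t    in y , ∈-++⁺ˡ y∈ , x∈σy
  ... | inj₂ x∈ts = let y , y∈ , x∈σy = varsˡ-[]⁻ ts σ x∈ts in y , ∈-++⁺ʳ (vars t) y∈ , x∈σy

  varsˡ-rename : ∀ ts {σ l} → (∀ {x} → x ∈ varsˡ ts → Renames σ l x) →
                 List.map l (varsˡ (List.map (_[ σ ]) ts)) ≡ varsˡ ts
  varsˡ-rename []       r = refl
  varsˡ-rename (t ∷ ts) {σ} {l} r = trans (List.map-++ l (vars (t [ σ ])) _)
    (cong₂ _++_ (vars-rename t (r ∘ ∈-++⁺ˡ)) (varsˡ-rename ts (r ∘ ∈-++⁺ʳ (vars t))))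

  map-[]-fixed : ∀ ts {σ} → (∀ {x} → x ∈ varsˡ ts → σ x ≡ var x) → List.map (_[ σ ]) ts ≡ ts
  map-[]-fixed []       fixed = refl
  map-[]-fixed (t ∷ ts) fixed = cong₂ _∷_
    (trans ([]-cong t (fixed ∘ ∈-++⁺ˡ)) ([]-var t)) (map-[]-fixed ts (fixed ∘ ∈-++⁺ʳ (vars t)))

  lookup-[] : ∀ {n} (ts : Vec Term n) σ i → lookup (ts [ σ ]ᵛ) i ≡ lookup ts i [ σ ]
  lookup-[] (t ∷ ts) σ Fin.zero    = refl
  lookup-[] (t ∷ ts) σ (Fin.suc i) = lookup-[] ts σ i

  vars-lookup : ∀ {n} (ts : Vec Term n) i {x} → x ∈ vars (lookup ts i) → x ∈ varsᵛ ts
  vars-lookup (t ∷ ts) Fin.zero    x∈ = ∈-++⁺ˡ x∈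
  vars-lookup (t ∷ ts) (Fin.suc i) x∈ = ∈-++⁺ʳ (vars t) (vars-lookup ts i x∈)

  []ᵃ-⨾ : ∀ a σ τ → a [ σ ]ᵃ [ τ ]ᵃ ≡ a [ σ ⨾ τ ]ᵃ
  []ᵃ-⨾ (p · ts) σ τ = cong (p ·_) ([]ᵛ-⨾ ts σ τ)

  []ᑫ-⨾ : ∀ Q σ τ → Q [ σ ]ᑫ [ τ ]ᑫ ≡ Q [ σ ⨾ τ ]ᑫ
  []ᑫ-⨾ Q σ τ = trans (sym (List.map-∘ Q)) (List.map-cong (λ a → []ᵃ-⨾ a σ τ) Q)

  []ᑫ-cong : ∀ Q {σ τ} → (∀ x → σ x ≡ τ x) → Q [ σ ]ᑫ ≡ Q [ τ ]ᑫ
  []ᑫ-cong Q eq = List.map-cong (λ a → cong (pred a ·_) ([]ᵛ-cong (args a) (λ _ → eq _))) Q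

  -- argTerms input and argTerms output are definitionally inputs and outputs.
  argTerms : Mode → Atom → List Term
  argTerms m a = List.map (lookup (args a)) (positions m (pred a))

  argVars : Mode → Atom → List Var
  argVars m a = varsˡ (argTerms m a)

  ∈-positions⁺ : ∀ {m p i} → mode p i ≡ m → i ∈ positions m p
  ∈-positions⁺ {m} {p} {i} eq = ∈-filter⁺ (λ i → mode p i ≟ᵐ m) (∈-allFin i) eq

  ∈-positions⁻ : ∀ {m p i} → i ∈ positions m p → mode p i ≡ m
  ∈-positions⁻ {m} {p} i∈ = proj₂ (∈-filter⁻ (λ i → mode p i ≟ᵐ m) {xs = allFin (arity p)} i∈)

  ∈-argTerms⁺ : ∀ {m} a {i} → mode (pred a) i ≡ m → lookup (args a) i ∈ argTerms m a
  ∈-argTerms⁺ a eq = ∈-map⁺ (lookup (args a)) (∈-positions⁺ eq)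

  ∈-varsˡ⁺ : ∀ {ts t x} → t ∈ ts → x ∈ vars t → x ∈ varsˡ ts
  ∈-varsˡ⁺ t∈ x∈ = ∈-concatMap⁺ vars (Any.map (λ { refl → x∈ }) t∈)

  ∈-argVars⁺ : ∀ {m} a {i x} → mode (pred a) i ≡ m → x ∈ vars (lookup (args a) i) → x ∈ argVars m a
  ∈-argVars⁺ a eq = ∈-varsˡ⁺ (∈-argTerms⁺ a eq)

  argVars⊆ : ∀ {m} a {x} → x ∈ argVars m a → x ∈ varsᵃ a
  argVars⊆ {m} a x∈ =
    let t , t∈ , x∈t = find (∈-concatMap⁻ vars {xs = argTerms m a} x∈)
        i , _ , eq   = ∈-map⁻ (lookup (args a)) t∈
    in  vars-lookup (args a) i (subst (λ t → _ ∈ vars t) eq x∈t)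

  ∈-varsᑫ⁺ : ∀ {Q a x} → a ∈ Q → x ∈ varsᵃ a → x ∈ varsᑫ Q
  ∈-varsᑫ⁺ a∈ x∈ = ∈-concatMap⁺ varsᵃ (Any.map (λ { refl → x∈ }) a∈)

  argTerms-[] : ∀ m a σ → argTerms m (a [ σ ]ᵃ) ≡ List.map (_[ σ ]) (argTerms m a)
  argTerms-[] m a σ = trans (List.map-cong (lookup-[] (args a) σ) (positions m (pred a)))
                            (List.map-∘ (positions m (pred a)))

  argTerms-fixed : ∀ m a {σ} → (∀ {x} → x ∈ argVars m a → σ x ≡ var x) →
                   argTerms m (a [ σ ]ᵃ) ≡ argTerms m a
  argTerms-fixed m a {σ} fixed = trans (argTerms-[] m a σ) (map-[]-fixed (argTerms m a) fixed)

  argVars-[]⁻ : ∀ m a σ {x} → x ∈ argVars m (a [ σ ]ᵃ) → ∃ λ y → y ∈ argVars m a × x ∈ vars (σ y)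
  argVars-[]⁻ m a σ x∈ =
    varsˡ-[]⁻ (argTerms m a) σ (subst (λ ts → _ ∈ varsˡ ts) (argTerms-[] m a σ) x∈)

  argVars-rename : ∀ m a {σ l} → (∀ {x} → x ∈ argVars m a → Renames σ l x) →
                   List.map l (argVars m (a [ σ ]ᵃ)) ≡ argVars m a
  argVars-rename m a {σ} {l} r = trans
    (cong (List.map l ∘ varsˡ) (argTerms-[] m a σ)) (varsˡ-rename (argTerms m a) r)

  module _ {σ : Subst} {l : Var → Var} where

    Unique-rename : ∀ m a → (∀ {x} → x ∈ varsᵃ a → Renames σ l x) →
                    Unique (argVars m a) → Unique (argVars m (a [ σ ]ᵃ))
    Unique-rename m a r u =
      Unique.map⁻ (subst Unique (sym (argVars-rename m a (r ∘ argVars⊆ a))) u)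

    Disjoint-rename : ∀ m a n b → (∀ {x} → x ∈ varsᵃ a → Renames σ l x) →
                      (∀ {x} → x ∈ varsᵃ b → Renames σ l x) →
                      Disjoint (argVars m a) (argVars n b) →
                      Disjoint (argVars m (a [ σ ]ᵃ)) (argVars n (b [ σ ]ᵃ))
    Disjoint-rename m a n b r s d (x∈a , x∈b) = d
      ( subst (_ ∈_) (argVars-rename m a (r ∘ argVars⊆ a)) (∈-map⁺ l x∈a)
      , subst (_ ∈_) (argVars-rename n b (s ∘ argVars⊆ b)) (∈-map⁺ l x∈b) )

-- One-way matching of flat terms.

module FlatMatching (S : Signature) where
  open Syntax S
  open Substitutions S

  Bindings : Set
  Bindings = List (Var × Term)

  keys : Bindings → List Var
  keys = List.map proj₁

  assoc : Bindings → Subst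
  assoc []             x = var x
  assoc ((y , u) ∷ bs) x with x ℕ.≟ y
  ... | yes _ = u
  ... | no  _ = assoc bs x

  assoc-∉ : ∀ bs {x} → x ∉ keys bs → assoc bs x ≡ var x
  assoc-∉ []             x∉ = refl
  assoc-∉ ((y , u) ∷ bs) {x} x∉ with x ℕ.≟ y
  ... | yes refl = contradiction (here refl) x∉
  ... | no  _    = assoc-∉ bs (x∉ ∘ there)

  assoc-view : ∀ bs x → (x , assoc bs x) ∈ bs ⊎ (x ∉ keys bs × assoc bs x ≡ var x)
  assoc-view []             x = inj₂ ((λ ()) , refl)
  assoc-view ((y , u) ∷ bs) x with x ℕ.≟ y
  ... | yes refl = inj₁ (here refl)
  ... | no  x≢y with assoc-view bs x
  ...   | inj₁ x∈         = inj₁ (there x∈)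
  ...   | inj₂ (x∉ , eq) = inj₂ ((λ { (here x≡y) → x≢y x≡y ; (there x∈) → x∉ x∈ }) , eq)

  assoc-++ˡ : ∀ bs cs {x} → x ∉ keys cs → assoc (bs ++ cs) x ≡ assoc bs x
  assoc-++ˡ []             cs x∉ = assoc-∉ cs x∉
  assoc-++ˡ ((y , u) ∷ bs) cs {x} x∉ with x ℕ.≟ y
  ... | yes _ = refl
  ... | no  _ = assoc-++ˡ bs cs x∉

  -- Keys and values get separate substitutions because two cases occur: `τ = var`, where `σ` sends
  -- each key to its value as it stands, and `τ = σ`, where `σ` is a unifier.
  Solves : Subst → Subst → Bindings → Set
  Solves σ τ = All λ (x , u) → σ x ≡ u [ τ ]

  assoc-solves : ∀ bs → Unique (keys bs) → Solves (assoc bs) var bs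
  assoc-solves bs u = All.tabulate λ {b} b∈ → trans (go bs u b∈) (sym ([]-var (proj₂ b)))
    where
    go : ∀ bs → Unique (keys bs) → ∀ {x u} → (x , u) ∈ bs → assoc bs x ≡ u
    go ((y , u) ∷ bs) (y∉ ∷ ubs) {x} b∈ with x ℕ.≟ y | b∈
    ... | yes refl | here refl = refl
    ... | yes refl | there b∈′ = contradiction refl (All.lookup y∉ (∈-map⁺ proj₁ b∈′))
    ... | no  x≢y  | here refl = contradiction refl x≢y
    ... | no  _    | there b∈′ = go bs ubs b∈′

  -- The equation t [ σ ] ≡ u [ τ ] in solved form.
  record Matching (t u : Term) : Set where
    field
      bindings : Bindings
      keys≡    : keys bindings ≡ vars t
      sound    : ∀ {σ τ} → Solves σ τ bindings → t [ σ ] ≡ u [ τ ]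
      complete : ∀ {σ τ} → t [ σ ] ≡ u [ τ ] → Solves σ τ bindings
      range    : All (λ (_ , v) → ∀ {x} → x ∈ vars v → x ∈ vars u) bindings

  match-var : ∀ x u → Matching (var x) u
  match-var x u = record
    { bindings = (x , u) ∷ []
    ; keys≡    = refl
    ; sound    = λ { (eq ∷ []) → eq }
    ; complete = λ eq → eq ∷ []
    ; range    = id ∷ []
    }

  bindᵛ : ∀ {n} → Vec Var n → Vec Term n → Bindings
  bindᵛ xs us = Vec.toList (Vec.zip xs us)

  keys-bindᵛ : ∀ {n} (xs : Vec Var n) us → keys (bindᵛ xs us) ≡ varsᵛ (Vec.map var xs)
  keys-bindᵛ []       []       = refl
  keys-bindᵛ (x ∷ xs) (u ∷ us) = cong (x ∷_) (keys-bindᵛ xs us)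

  bindᵛ-sound : ∀ {n} (xs : Vec Var n) us {σ τ} → Solves σ τ (bindᵛ xs us) →
                Vec.map var xs [ σ ]ᵛ ≡ us [ τ ]ᵛ
  bindᵛ-sound []       []       []         = refl
  bindᵛ-sound (x ∷ xs) (u ∷ us) (eq ∷ eqs) = cong₂ _∷_ eq (bindᵛ-sound xs us eqs)

  bindᵛ-complete : ∀ {n} (xs : Vec Var n) us {σ τ} → Vec.map var xs [ σ ]ᵛ ≡ us [ τ ]ᵛ →
                   Solves σ τ (bindᵛ xs us)
  bindᵛ-complete []       []       eq = []
  bindᵛ-complete (x ∷ xs) (u ∷ us) eq =
    Vec.∷-injectiveˡ eq ∷ bindᵛ-complete xs us (Vec.∷-injectiveʳ eq)

  bindᵛ-range : ∀ {n} (xs : Vec Var n) us →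
                All (λ (_ , v) → ∀ {x} → x ∈ vars v → x ∈ varsᵛ us) (bindᵛ xs us)
  bindᵛ-range []       []       = []
  bindᵛ-range (x ∷ xs) (u ∷ us) =
    ∈-++⁺ˡ ∷ All.map (λ v⊆ {_} y∈ → ∈-++⁺ʳ (vars u) (v⊆ y∈)) (bindᵛ-range xs us)

  fn-injectiveˡ : ∀ {f g ts us} → fn f ts ≡ fn g us → f ≡ g
  fn-injectiveˡ refl = refl

  -- The instance equation serves to identify the function symbols. Below the symbol a flat term has
  -- only variables, so decomposition stops after one layer, and `nv` excludes the case in which a
  -- variable of `u` would have to be bound.
  match-flat : ∀ {t} → Flat t → ∀ u → (NonVar t → NonVar u) →
               ∀ {σ τ} → t [ σ ] ≡ u [ τ ] → Matching t u
  match-flat (flat-var x)      u         nv eq = match-var x u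
  match-flat (flat-fn f xs xs!) (var y)   nv eq = contradiction (is-var y) (nv λ ())
  match-flat (flat-fn f xs xs!) (fn g us) nv eq with refl ← fn-injectiveˡ eq = record
    { bindings = bindᵛ xs us
    ; keys≡    = keys-bindᵛ xs us
    ; sound    = cong (fn f) ∘ bindᵛ-sound xs us
    ; complete = bindᵛ-complete xs us ∘ fn-injectiveʳ
    ; range    = bindᵛ-range xs us
    }

  record Matchings {I : Set} (t u : I → Term) (is : List I) : Set where
    field
      bindings : Bindings
      keys≡    : keys bindings ≡ varsˡ (List.map t is)
      sound    : ∀ {σ τ} → Solves σ τ bindings → ∀ {i} → i ∈ is → t i [ σ ] ≡ u i [ τ ]
      complete : ∀ {σ τ} → (∀ {i} → i ∈ is → t i [ σ ] ≡ u i [ τ ]) → Solves σ τ bindings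
      range    : All (λ (_ , v) → ∀ {x} → x ∈ vars v → x ∈ varsˡ (List.map u is)) bindings

  matchings : ∀ {I : Set} {t u : I → Term} is →
              (∀ {i} → i ∈ is → Matching (t i) (u i)) → Matchings t u is
  matchings [] m = record
    { bindings = []
    ; keys≡    = refl
    ; sound    = λ _ ()
    ; complete = λ _ → []
    ; range    = []
    }
  matchings {u = u} (i ∷ is) m = record
    { bindings = M.bindings ++ Ms.bindings
    ; keys≡    = trans (List.map-++ proj₁ M.bindings Ms.bindings) (cong₂ _++_ M.keys≡ Ms.keys≡)
    ; sound    = λ { s (here refl) → M.sound (All.++⁻ˡ M.bindings s)
                   ; s (there i∈)  → Ms.sound (All.++⁻ʳ M.bindings s) i∈ }
    ; complete = λ eq → All.++⁺ (M.complete (eq (here refl))) (Ms.complete (eq ∘ there))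
    ; range    = All.++⁺ (All.map (λ v⊆ {_} x∈ → ∈-++⁺ˡ (v⊆ x∈)) M.range)
                         (All.map (λ v⊆ {_} x∈ → ∈-++⁺ʳ (vars (u i)) (v⊆ x∈)) Ms.range)
    }
    where
    module M  = Matching (m (here refl))
    module Ms = Matchings (matchings is (m ∘ there))

-- Unification of a selected atom with a clause head.

module Unification (S : Signature) where
  open Syntax S
  open Substitutions S
  open FlatMatching S

  module _ {p : Pred} {ts us : Vec Term (arity p)} {σ : Subst} where

    unifier⁻ : Unifier (p · ts) (p · us) σ → ∀ i → lookup ts i [ σ ] ≡ lookup us i [ σ ]
    unifier⁻ eq i = trans (sym (lookup-[] ts σ i))
      (trans (cong (λ vs → lookup vs i) (args-injective eq)) (lookup-[] us σ i))
      where
      args-injective : ∀ {vs ws} → p · vs ≡ p · ws → vs ≡ ws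
      args-injective refl = refl

    -- The mode is a separate argument so that the equation can be proved by cases on it.
    unifier⁺ : (∀ m i → mode p i ≡ m → lookup ts i [ σ ] ≡ lookup us i [ σ ]) →
               Unifier (p · ts) (p · us) σ
    unifier⁺ eq = cong (p ·_) (trans (sym (Vec.tabulate∘lookup _))
      (trans (Vec.tabulate-cong λ i →
               trans (lookup-[] ts σ i) (trans (eq _ i refl) (sym (lookup-[] us σ i))))
             (Vec.tabulate∘lookup _)))

  -- What simple typing demands of a single atom of a query; the last condition is the case i = j of
  -- nice modedness.
  SafeOutputs : Atom → Set
  SafeOutputs a = All IsVar (argTerms output a)
                × Unique (argVars output a)
                × Disjoint (argVars input a) (argVars output a)

  -- The most general unifier that instantiates the input variables of the
  -- head h, and then the output variables of the goal a.
  record InputMGU (a h : Atom) : Set where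
    field
      θ₀         : Subst
      unifier    : Unifier a h θ₀
      absorbed   : ∀ {σ} → Unifier a h σ → ∀ x → θ₀ x [ σ ] ≡ σ x
      fixed      : ∀ {x} → x ∉ argVars input h → x ∉ argVars output a → θ₀ x ≡ var x
      head-range : ∀ {x y} → x ∈ argVars input h → y ∈ vars (θ₀ x) → y ∈ argVars input a
      goal-range : ∀ {x y} → x ∈ argVars output a → y ∈ vars (θ₀ x) →
                   y ∈ varsᵃ h ⊎ y ∈ argVars input a

  module _ {p : Pred} {ts us : Vec Term (arity p)}
           (safe   : SafeOutputs (p · ts))
           (linear : Linear (inputs (p · us)))
           (flat   : ∀ i → mode p i ≡ input → Flat (lookup us i))
           (nonvar : ∀ i → mode p i ≡ input → NonVar (lookup us i) → NonVar (lookup ts i))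
           (apart  : ∀ {x} → x ∈ varsᵃ (p · us) → x ∉ varsᵃ (p · ts))
           {θ : Subst} (unifiable : Unifier (p · ts) (p · us) θ) where

    private
      a h : Atom
      a = p · ts
      h = p · us

      module In = Matchings (matchings {t = lookup us} {u = lookup ts} (positions input p)
        λ {i} i∈ → match-flat (flat i (∈-positions⁻ i∈)) (lookup ts i) (nonvar i (∈-positions⁻ i∈))
                              (sym (unifier⁻ unifiable i)))

      θ₁ : Subst
      θ₁ = assoc In.bindings

      -- The head outputs are instantiated by `θ₁` beforehand, so that the single simultaneous
      -- substitution `θ₀` performs both stages.
      match-output : ∀ {i} → i ∈ positions output p → Matching (lookup ts i) (lookup us i [ θ₁ ])
      match-output {i} i∈ with lookup ts i | All.lookup (proj₁ safe) (∈-map⁺ (lookup ts) i∈)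
      ... | .(var x) | is-var x = match-var x _

      module Out = Matchings (matchings (positions output p) match-output)

      bindings : Bindings
      bindings = In.bindings ++ Out.bindings

      θ₀ : Subst
      θ₀ = assoc bindings

      keys-In : ∀ {x} → x ∈ keys In.bindings → x ∈ argVars input h
      keys-In = subst (_ ∈_) In.keys≡

      keys-Out : ∀ {x} → x ∈ keys Out.bindings → x ∈ argVars output a
      keys-Out = subst (_ ∈_) Out.keys≡

      keys-bindings : ∀ {x} → x ∈ keys bindings → x ∈ argVars input h ⊎ x ∈ argVars output a
      keys-bindings x∈
        with ∈-++⁻ (keys In.bindings) (subst (_ ∈_) (List.map-++ proj₁ In.bindings Out.bindings) x∈)
      ... | inj₁ x∈in  = inj₁ (keys-In x∈in)
      ... | inj₂ x∈out = inj₂ (keys-Out x∈out)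

      unique : Unique (keys bindings)
      unique = subst Unique (sym (List.map-++ proj₁ In.bindings Out.bindings))
        (Unique.++⁺ (subst Unique (sym In.keys≡) linear)
                    (subst Unique (sym Out.keys≡) (proj₁ (proj₂ safe)))
                    λ (x∈in , x∈out) →
                      apart (argVars⊆ h (keys-In x∈in)) (argVars⊆ a (keys-Out x∈out)))

      fixed : ∀ {x} → x ∉ argVars input h → x ∉ argVars output a → θ₀ x ≡ var x
      fixed x∉h x∉a = assoc-∉ bindings λ x∈ → [ x∉h , x∉a ]′ (keys-bindings x∈)

      solves : Solves θ₀ var In.bindings × Solves θ₀ var Out.bindings
      solves = All.++⁻ In.bindings (assoc-solves bindings unique)

      input-fixed : ∀ i → mode p i ≡ input → lookup ts i [ θ₀ ] ≡ lookup ts i [ var ]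
      input-fixed i eq = []-cong (lookup ts i) λ x∈ → fixed
        (λ x∈h → apart (argVars⊆ h x∈h) (vars-lookup ts i x∈))
        (λ x∈a → proj₂ (proj₂ safe) (∈-argVars⁺ a eq x∈ , x∈a))

      θ₀-head : ∀ {x} → x ∈ varsᵃ h → θ₀ x ≡ θ₁ x
      θ₀-head x∈ = assoc-++ˡ In.bindings Out.bindings
        λ x∈out → apart x∈ (argVars⊆ a (keys-Out x∈out))

      unifies : ∀ m i → mode p i ≡ m → lookup ts i [ θ₀ ] ≡ lookup us i [ θ₀ ]
      unifies input  i eq = trans (input-fixed i eq)
        (sym (In.sound (proj₁ solves) (∈-positions⁺ eq)))
      unifies output i eq = trans (Out.sound (proj₂ solves) (∈-positions⁺ eq)) (trans ([]-var _)
        (sym ([]-cong (lookup us i) (θ₀-head ∘ vars-lookup us i))))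

      absorb : ∀ {σ} bs → Solves σ σ bs → ∀ x → assoc bs x [ σ ] ≡ σ x
      absorb {σ} bs s x with assoc-view bs x
      ... | inj₁ x∈       = sym (All.lookup s x∈)
      ... | inj₂ (_ , eq) = cong (_[ σ ]) eq

      -- A unifier solves the input bindings, hence absorbs `θ₁`, hence solves the output bindings
      -- too. So it factors through `θ₀` by itself, as for an idempotent most general unifier.
      absorbed : ∀ {σ} → Unifier a h σ → ∀ x → θ₀ x [ σ ] ≡ σ x
      absorbed {σ} u = absorb bindings (All.++⁺ s-in (Out.complete λ {i} _ →
          trans (unifier⁻ u i) (sym (trans ([]-⨾ (lookup us i) θ₁ σ)
            ([]-cong (lookup us i) λ {x} _ → absorb In.bindings s-in x)))))
        where
        s-in : Solves σ σ In.bindings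
        s-in = In.complete λ {i} _ → sym (unifier⁻ u i)

      θ₁-range : ∀ {x y} → y ∈ vars (θ₁ x) → y ≡ x ⊎ y ∈ argVars input a
      θ₁-range {x} y∈ with assoc-view In.bindings x
      ... | inj₁ x∈ = inj₂ (All.lookup In.range x∈ y∈)
      ... | inj₂ (_ , eq) with here refl ← subst (λ t → _ ∈ vars t) eq y∈ = inj₁ refl

      head-range : ∀ {x y} → x ∈ argVars input h → y ∈ vars (θ₀ x) → y ∈ argVars input a
      head-range {x} x∈ y∈ = All.lookup In.range x,θ₁x∈
        (subst (λ t → _ ∈ vars t) (θ₀-head (argVars⊆ h x∈)) y∈)
        where
        x,θ₁x∈ : (x , θ₁ x) ∈ In.bindings
        x,θ₁x∈ with assoc-view In.bindings x
        ... | inj₁ b∈       = b∈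
        ... | inj₂ (x∉ , _) = contradiction (subst (x ∈_) (sym In.keys≡) x∈) x∉

      goal-range : ∀ {x y} → x ∈ argVars output a → y ∈ vars (θ₀ x) →
                   y ∈ varsᵃ h ⊎ y ∈ argVars input a
      goal-range {x} x∈ y∈ with assoc-view bindings x
      ... | inj₂ (x∉ , _) = contradiction
        (subst (x ∈_) (sym (List.map-++ proj₁ In.bindings Out.bindings))
          (∈-++⁺ʳ (keys In.bindings) (subst (x ∈_) (sym Out.keys≡) x∈))) x∉
      ... | inj₁ b∈ with ∈-++⁻ In.bindings b∈
      ...   | inj₁ b∈in  = inj₂ (All.lookup In.range b∈in y∈)
      -- Here `x` is bound to a head output instantiated by `θ₁`, so `y` comes from a variable `z`
      -- of the head outputs that `θ₁` either keeps or replaces by part of an input of the goal.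
      ...   | inj₂ b∈out
        with z , z∈ , y∈θ₁z ← varsˡ-[]⁻ (argTerms output h) θ₁
               (subst (λ ts → _ ∈ varsˡ ts) (List.map-∘ (positions output p))
                 (All.lookup Out.range b∈out y∈))
        with θ₁-range {z} y∈θ₁z
      ...     | inj₁ refl = inj₁ (argVars⊆ h z∈)
      ...     | inj₂ y∈a  = inj₂ y∈a

    inputMGU : InputMGU a h
    inputMGU = record
      { θ₀         = θ₀
      ; unifier    = unifier⁺ unifies
      ; absorbed   = absorbed
      ; fixed      = fixed
      ; head-range = head-range
      ; goal-range = goal-range
      }

-- Preservation of nice modedness under resolution.

module OrderedModes (S : Signature) where
  open Syntax S
  open Substitutions S
  open Unification S

  -- The first component is nice modedness for i < j, the second the part of linearity that concerns
  -- two different atoms.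
  Before : Atom → Atom → Set
  Before b c = Disjoint (argVars input b) (argVars output c)
             × Disjoint (argVars output b) (argVars output c)

  -- A nicely moded query, with variables as outputs, listed in the order of π.
  record NicelyOrdered (Q : Query) : Set where
    constructor nicelyOrdered
    field
      atoms : All SafeOutputs Q
      pairs : AllPairs Before Q

  NicelyOrdered-rename : ∀ {Q σ l} → (∀ {x} → x ∈ varsᑫ Q → Renames σ l x) →
                         NicelyOrdered Q → NicelyOrdered (Q [ σ ]ᑫ)
  NicelyOrdered-rename {Q} {σ} r (nicelyOrdered atoms pairs) = nicelyOrdered
    (All.map⁺ (All.tabulate λ {b} b∈ →
      let vs , u , d = All.lookup atoms b∈ in
        subst (All IsVar) (sym (argTerms-[] output b σ))
          (All.map⁺ (All.tabulate λ t∈ →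
            IsVar-rename (λ x∈ → rᵃ b∈ (argVars⊆ b (∈-varsˡ⁺ t∈ x∈))) (All.lookup vs t∈)))
      , Unique-rename output b (rᵃ b∈) u
      , Disjoint-rename input b output b (rᵃ b∈) (rᵃ b∈) d))
    (AllPairs.map⁺ (AllPairs-map∈ (λ {b} {c} b∈ c∈ (d , e) →
        Disjoint-rename input b output c (rᵃ b∈) (rᵃ c∈) d
      , Disjoint-rename output b output c (rᵃ b∈) (rᵃ c∈) e) pairs))
    where
    rᵃ : ∀ {b} → b ∈ Q → ∀ {x} → x ∈ varsᵃ b → Renames σ _ x
    rᵃ b∈ x∈ = r (∈-varsᑫ⁺ b∈ x∈)

  module _ {a h L B M}
           (goal  : NicelyOrdered (L ++ a ∷ M))
           (body! : NicelyOrdered B)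
           (fresh : ∀ {b} → b ∈ B → Disjoint (argVars input h) (argVars output b))
           (apart : Disjoint (varsᶜ (h ⟵ B)) (varsᑫ (L ++ a ∷ M)))
           (mgu   : InputMGU a h) where

    open InputMGU mgu

    private
      module G = NicelyOrdered goal
      module C = NicelyOrdered body!

      L∈ : ∀ {b} → b ∈ L → b ∈ L ++ a ∷ M
      L∈ = ∈-++⁺ˡ

      M∈ : ∀ {b} → b ∈ M → b ∈ L ++ a ∷ M
      M∈ = ∈-++⁺ʳ L ∘ there

      a∈ : a ∈ L ++ a ∷ M
      a∈ = ∈-++⁺ʳ L (here refl)

      head∉goal : ∀ {b x} → x ∈ varsᵃ h → b ∈ L ++ a ∷ M → x ∉ varsᵃ b
      head∉goal x∈h b∈ x∈b = apart (∈-++⁺ˡ x∈h , ∈-varsᑫ⁺ b∈ x∈b)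

      body∉goal : ∀ {b c x} → c ∈ B → x ∈ varsᵃ c → b ∈ L ++ a ∷ M → x ∉ varsᵃ b
      body∉goal c∈ x∈c b∈ x∈b = apart (∈-++⁺ʳ (varsᵃ h) (∈-varsᑫ⁺ c∈ x∈c) , ∈-varsᑫ⁺ b∈ x∈b)

      L-pairs = proj₁ (AllPairs-++⁻ L G.pairs)
      L-aM    = proj₂ (proj₂ (AllPairs-++⁻ L G.pairs))
      aM      = proj₁ (proj₂ (AllPairs-++⁻ L G.pairs))

      L<a : ∀ {b} → b ∈ L → Before b a
      L<a b∈ with b<a ∷ _ ← All.lookup L-aM b∈ = b<a

      L<M : ∀ {b c} → b ∈ L → c ∈ M → Before b c
      L<M b∈ c∈ with _ ∷ b<M ← All.lookup L-aM b∈ = All.lookup b<M c∈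

      a<M : ∀ {c} → c ∈ M → Before a c
      a<M c∈ with a<M′ ∷ _ ← aM = All.lookup a<M′ c∈

      M-pairs : AllPairs Before M
      M-pairs with _ ∷ ps ← aM = ps

      disjoint⇒before : ∀ b c → (∀ {x} → x ∈ varsᵃ b → x ∉ varsᵃ c) → Before b c
      disjoint⇒before b c d = (λ (x∈b , x∈c) → d (argVars⊆ b x∈b) (argVars⊆ c x∈c))
                                , (λ (x∈b , x∈c) → d (argVars⊆ b x∈b) (argVars⊆ c x∈c))

      L<B : ∀ {b c} → b ∈ L → c ∈ B → Before b c
      L<B {b} {c} b∈ c∈ = disjoint⇒before b c λ x∈b x∈c → body∉goal c∈ x∈c (L∈ b∈) x∈b

      B<M : ∀ {b c} → b ∈ B → c ∈ M → Before b c
      B<M {b} {c} b∈ c∈ = disjoint⇒before b c λ x∈b → body∉goal b∈ x∈b (M∈ c∈)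

      -- The key to preservation: `θ₀` moves only head inputs and outputs of `a`, and none of these
      -- is an output variable of another atom. Outputs thus remain the same distinct variables, and
      -- only variables newly entering inputs have to be controlled.
      FixedOutputs : Atom → Set
      FixedOutputs b = argTerms output (b [ θ₀ ]ᵃ) ≡ argTerms output b

      fixed-L : ∀ {b} → b ∈ L → FixedOutputs b
      fixed-L {b} b∈ = argTerms-fixed output b λ x∈ → fixed
        (λ x∈h → head∉goal (argVars⊆ h x∈h) (L∈ b∈) (argVars⊆ b x∈))
        (λ x∈a → proj₂ (L<a b∈) (x∈ , x∈a))

      fixed-B : ∀ {b} → b ∈ B → FixedOutputs b
      fixed-B {b} b∈ = argTerms-fixed output b λ x∈ → fixed
        (λ x∈h → fresh b∈ (x∈h , x∈))
        (λ x∈a → body∉goal b∈ (argVars⊆ b x∈) a∈ (argVars⊆ a x∈a))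

      fixed-M : ∀ {b} → b ∈ M → FixedOutputs b
      fixed-M {b} b∈ = argTerms-fixed output b λ x∈ → fixed
        (λ x∈h → head∉goal (argVars⊆ h x∈h) (M∈ b∈) (argVars⊆ b x∈))
        (λ x∈a → proj₂ (a<M b∈) (x∈a , x∈))

      -- Atoms before `a` do not consume its outputs, so their inputs are untouched by `θ₀`.
      input-L : ∀ {b x} → b ∈ L → x ∈ argVars input (b [ θ₀ ]ᵃ) → x ∈ argVars input b
      input-L {b} b∈ = subst (λ ts → _ ∈ varsˡ ts) (argTerms-fixed input b λ x∈ → fixed
        (λ x∈h → head∉goal (argVars⊆ h x∈h) (L∈ b∈) (argVars⊆ b x∈))
        (λ x∈a → proj₁ (L<a b∈) (x∈ , x∈a)))

      θ₀-range : ∀ {x y} → y ∈ vars (θ₀ x) →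
                 y ≡ x ⊎ y ∈ argVars input a ⊎ (x ∈ argVars output a × y ∈ varsᵃ h)
      θ₀-range {x} y∈ with Any.any? (x ℕ.≟_) (argVars input h)
      ... | yes x∈h = inj₂ (inj₁ (head-range x∈h y∈))
      ... | no  x∉h with Any.any? (x ℕ.≟_) (argVars output a)
      ...   | yes x∈a = [ (λ y∈h → inj₂ (inj₂ (x∈a , y∈h))) , inj₂ ∘ inj₁ ]′ (goal-range x∈a y∈)
      ...   | no  x∉a with here refl ← subst (λ t → _ ∈ vars t) (fixed x∉h x∉a) y∈ = inj₁ refl

      -- Body atoms share no variable with the goal, so they can change only through the head
      -- inputs, which receive input variables of `a`.
      input-B : ∀ {b x} → b ∈ B → x ∈ argVars input (b [ θ₀ ]ᵃ) →
                x ∈ argVars input b ⊎ x ∈ argVars input a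
      input-B {b} b∈ x∈ with y , y∈b , x∈θ₀y ← argVars-[]⁻ input b θ₀ x∈ with θ₀-range {y} x∈θ₀y
      ... | inj₁ refl              = inj₁ y∈b
      ... | inj₂ (inj₁ x∈a)        = inj₂ x∈a
      ... | inj₂ (inj₂ (y∈a , _)) =
        contradiction (argVars⊆ a y∈a) (body∉goal b∈ (argVars⊆ b y∈b) a∈)

      -- Atoms after `a` may consume its outputs and so receive head variables; these are harmless,
      -- since the clause is apart from the goal.
      input-M : ∀ {b x} → x ∈ argVars input (b [ θ₀ ]ᵃ) →
                x ∈ argVars input b ⊎ x ∈ argVars input a ⊎ x ∈ varsᵃ h
      input-M {b} x∈ with y , y∈b , x∈θ₀y ← argVars-[]⁻ input b θ₀ x∈ with θ₀-range {y} x∈θ₀y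
      ... | inj₁ refl             = inj₁ y∈b
      ... | inj₂ (inj₁ x∈a)       = inj₂ (inj₁ x∈a)
      ... | inj₂ (inj₂ (_ , x∈h)) = inj₂ (inj₂ x∈h)

      before-[] : ∀ b c → FixedOutputs b → FixedOutputs c →
                  (∀ {x} → x ∈ argVars input (b [ θ₀ ]ᵃ) → x ∉ argVars output c) →
                  Disjoint (argVars output b) (argVars output c) →
                  Before (b [ θ₀ ]ᵃ) (c [ θ₀ ]ᵃ)
      before-[] b c fb fc d e =
          (λ (x∈b , x∈c) → d x∈b (subst (λ ts → _ ∈ varsˡ ts) fc x∈c))
        , (λ (x∈b , x∈c) → e ( subst (λ ts → _ ∈ varsˡ ts) fb x∈b
                              , subst (λ ts → _ ∈ varsˡ ts) fc x∈c))

      safe-[] : ∀ b → FixedOutputs b →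
                (∀ {x} → x ∈ argVars input (b [ θ₀ ]ᵃ) → x ∉ argVars output b) →
                SafeOutputs b → SafeOutputs (b [ θ₀ ]ᵃ)
      safe-[] b fb d (vs , u , _) =
          subst (All IsVar) (sym fb) vs
        , subst (Unique ∘ varsˡ) (sym fb) u
        , λ (x∈i , x∈o) → d x∈i (subst (λ ts → _ ∈ varsˡ ts) fb x∈o)

      input∉-L : ∀ b c → b ∈ L → Disjoint (argVars input b) (argVars output c) →
                 ∀ {x} → x ∈ argVars input (b [ θ₀ ]ᵃ) → x ∉ argVars output c
      input∉-L b c b∈ d x∈b x∈c = d (input-L b∈ x∈b , x∈c)

      input∉-B : ∀ b c → b ∈ B → Disjoint (argVars input b) (argVars output c) →
                 Disjoint (argVars input a) (argVars output c) →
                 ∀ {x} → x ∈ argVars input (b [ θ₀ ]ᵃ) → x ∉ argVars output c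
      input∉-B b c b∈ d e x∈b x∈c =
        [ (λ x∈ → d (x∈ , x∈c)) , (λ x∈ → e (x∈ , x∈c)) ]′ (input-B b∈ x∈b)

      input∉-M : ∀ b c → c ∈ M → Disjoint (argVars input b) (argVars output c) →
                 ∀ {x} → x ∈ argVars input (b [ θ₀ ]ᵃ) → x ∉ argVars output c
      input∉-M b c c∈ d x∈b x∈c with input-M {b} x∈b
      ... | inj₁ x∈         = d (x∈ , x∈c)
      ... | inj₂ (inj₁ x∈a) = proj₁ (a<M c∈) (x∈a , x∈c)
      ... | inj₂ (inj₂ x∈h) = head∉goal x∈h (M∈ c∈) (argVars⊆ c x∈c)

      a∉B : ∀ {c} → c ∈ B → Disjoint (argVars input a) (argVars output c)
      a∉B {c} c∈ (x∈a , x∈c) = body∉goal c∈ (argVars⊆ c x∈c) a∈ (argVars⊆ a x∈a)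

      resolvent-atoms : All (SafeOutputs ∘ _[ θ₀ ]ᵃ) (L ++ B ++ M)
      resolvent-atoms = All.++⁺
        (All.tabulate λ {b} b∈ → let s = All.lookup G.atoms (L∈ b∈) in
          safe-[] b (fixed-L b∈) (input∉-L b b b∈ (proj₂ (proj₂ s))) s)
        (All.++⁺
          (All.tabulate λ {b} b∈ → let s = All.lookup C.atoms b∈ in
            safe-[] b (fixed-B b∈) (input∉-B b b b∈ (proj₂ (proj₂ s)) (a∉B b∈)) s)
          (All.tabulate λ {b} b∈ → let s = All.lookup G.atoms (M∈ b∈) in
            safe-[] b (fixed-M b∈) (input∉-M b b b∈ (proj₂ (proj₂ s))) s))

      resolvent-pairs : AllPairs (λ b c → Before (b [ θ₀ ]ᵃ) (c [ θ₀ ]ᵃ)) (L ++ B ++ M)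
      resolvent-pairs = AllPairs.++⁺
        (AllPairs-map∈ (λ {b} {c} b∈ c∈ (d , e) →
          before-[] b c (fixed-L b∈) (fixed-L c∈) (input∉-L b c b∈ d) e) L-pairs)
        (AllPairs.++⁺
          (AllPairs-map∈ (λ {b} {c} b∈ c∈ (d , e) →
            before-[] b c (fixed-B b∈) (fixed-B c∈) (input∉-B b c b∈ d (a∉B c∈)) e) C.pairs)
          (AllPairs-map∈ (λ {b} {c} b∈ c∈ (d , e) →
            before-[] b c (fixed-M b∈) (fixed-M c∈) (input∉-M b c c∈ d) e) M-pairs)
          (All.tabulate λ {b} b∈ → All.tabulate λ {c} c∈ → let d , e = B<M b∈ c∈ in
            before-[] b c (fixed-B b∈) (fixed-M c∈) (input∉-B b c b∈ d (proj₁ (a<M c∈))) e))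
        (All.tabulate λ {b} b∈ → All.++⁺
          (All.tabulate λ {c} c∈ → let d , e = L<B b∈ c∈ in
            before-[] b c (fixed-L b∈) (fixed-B c∈) (input∉-L b c b∈ d) e)
          (All.tabulate λ {c} c∈ → let d , e = L<M b∈ c∈ in
            before-[] b c (fixed-L b∈) (fixed-M c∈) (input∉-L b c b∈ d) e))

    NicelyOrdered-resolvent₀ : NicelyOrdered ((L ++ B ++ M) [ θ₀ ]ᑫ)
    NicelyOrdered-resolvent₀ =
      nicelyOrdered (All.map⁺ resolvent-atoms) (AllPairs.map⁺ resolvent-pairs)

    -- The unifiers factor through each other: `θ` is `θ₀ ⨾ θ` by absorption, and `θ₀` is `θ ⨾ δ` by
    -- generality of `θ`. So `δ` undoes `θ` on the variables of the `θ₀`-resolvent, and `θ` renames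
    -- that resolvent to its own.
    NicelyOrdered-resolvent : ∀ {θ} → MGU a h θ → NicelyOrdered ((L ++ B ++ M) [ θ ]ᑫ)
    NicelyOrdered-resolvent {θ} (u , most-general) with δ , θ₀≡θδ ← most-general θ₀ unifier =
      subst NicelyOrdered
        (trans ([]ᑫ-⨾ (L ++ B ++ M) θ₀ θ) ([]ᑫ-cong (L ++ B ++ M) (absorbed u)))
        (NicelyOrdered-rename (λ x∈ → renames {θ} {δ} (θδ-fixes x∈)) NicelyOrdered-resolvent₀)
      where
      θδ-fixes : ∀ {x} → x ∈ varsᑫ ((L ++ B ++ M) [ θ₀ ]ᑫ) → θ x [ δ ] ≡ var x
      θδ-fixes x∈
        with a′ , a′∈ , x∈a′ ← find (∈-concatMap⁻ varsᵃ {xs = (L ++ B ++ M) [ θ₀ ]ᑫ} x∈)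
        with c , _ , refl ← ∈-map⁻ (_[ θ₀ ]ᵃ) a′∈
        with y , _ , x∈θ₀y ← varsᵛ-[]⁻ (args c) θ₀ x∈a′ =
        -- The whole term `θ₀ y` is fixed by `θ ⨾ δ`, hence so is its variable `x`.
        []-cong⁻ (θ₀ y) {θ ⨾ δ} {var} (begin
          θ₀ y [ θ ⨾ δ ]   ≡⟨ []-⨾ (θ₀ y) θ δ ⟨
          θ₀ y [ θ ] [ δ ] ≡⟨ cong (_[ δ ]) (absorbed u y) ⟩
          θ y [ δ ]        ≡⟨ θ₀≡θδ y ⟨
          θ₀ y             ≡⟨ []-var (θ₀ y) ⟨
          θ₀ y [ var ]     ∎) x∈θ₀y
        where open ≡-Reasoning

-- Well-typedness along an order.

module OrderedTyping (S : Signature) (τ : Syntax.Typing S) where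
  open Syntax S
  open Typed τ
  open Substitutions S
  open FlatMatching S
  open Unification S
  open OrderedModes S

  -- Left-to-right typing of one fixed instance. Quantification over substitutions stays outside, so
  -- chains can be split and joined without mentioning it.
  WellTypedChain : Query → Set
  WellTypedChain []      = ⊤
  WellTypedChain (a ∷ Q) = InputsTyped a × (OutputsTyped a → WellTypedChain Q)

  chain-++⁺ : ∀ L {M} → WellTypedChain L → (All OutputsTyped L → WellTypedChain M) →
              WellTypedChain (L ++ M)
  chain-++⁺ []      _        m = m []
  chain-++⁺ (a ∷ L) (in! , l) m = in! , λ out! → chain-++⁺ L (l out!) (m ∘ (out! ∷_))

  chain-++⁻ : ∀ L {M} → WellTypedChain (L ++ M) →
              WellTypedChain L × (All OutputsTyped L → WellTypedChain M)
  chain-++⁻ []      m = tt , λ _ → m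
  chain-++⁻ (a ∷ L) (in! , l) =
      (in! , λ out! → proj₁ (chain-++⁻ L (l out!)))
    , λ { (out! ∷ outs!) → proj₂ (chain-++⁻ L (l out!)) outs! }

  chain-inputs : ∀ {Q} → WellTypedChain Q → All OutputsTyped Q → All InputsTyped Q
  chain-inputs {[]}    _         _              = []
  chain-inputs {_ ∷ _} (in! , c) (out! ∷ outs!) = in! ∷ chain-inputs (c out!) outs!

  arrange : ∀ Q → Permutation′ (length Q) → Query
  arrange Q π = List.map (List.lookup Q) (ranked π)

  arrange-↭ : ∀ Q π → arrange Q π ↭ Q
  arrange-↭ Q π = ↭-trans (↭.map⁺ (List.lookup Q) (ranked-↭ π))
    (↭-reflexive (trans (List.map-tabulate id (List.lookup Q)) (List.tabulate-lookup Q)))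

  chain-arrange : ∀ Q π σ →
    (∀ i → (∀ j → (π ⟨$⟩ʳ j) Fin.< (π ⟨$⟩ʳ i) → OutputsTyped (List.lookup Q j [ σ ]ᵃ)) →
           InputsTyped (List.lookup Q i [ σ ]ᵃ)) →
    WellTypedChain (arrange Q π [ σ ]ᑫ)
  chain-arrange Q π σ typed = go (ranked π) (ranked-increasing π) (inj₁ ∘ ∈-ranked π)
    where
    -- Invariant: every index is still to come or already has typed outputs. An index ranked below
    -- the first remaining one cannot be among the remaining ones, so its outputs are typed.
    go : ∀ is → AllPairs (λ i j → (π ⟨$⟩ʳ i) Fin.< (π ⟨$⟩ʳ j)) is →
         (∀ j → j ∈ is ⊎ OutputsTyped (List.lookup Q j [ σ ]ᵃ)) →
         WellTypedChain (List.map (List.lookup Q) is [ σ ]ᑫ)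
    go []       _          _    = tt
    go (i ∷ is) (i< ∷ is<) done = typed i earlier , λ out! → go is is< (later out!)
      where
      earlier : ∀ j → (π ⟨$⟩ʳ j) Fin.< (π ⟨$⟩ʳ i) → OutputsTyped (List.lookup Q j [ σ ]ᵃ)
      earlier j j<i with done j
      ... | inj₁ (here refl) = contradiction j<i (ℕ.<-irrefl refl)
      ... | inj₁ (there j∈)  = contradiction j<i (ℕ.<-asym (All.lookup i< j∈))
      ... | inj₂ out!        = out!

      later : OutputsTyped (List.lookup Q i [ σ ]ᵃ) →
              ∀ j → j ∈ is ⊎ OutputsTyped (List.lookup Q j [ σ ]ᵃ)
      later out! j with done j
      ... | inj₁ (here refl) = inj₂ out!
      ... | inj₁ (there j∈)  = inj₁ j∈
      ... | inj₂ out!′       = inj₂ out!′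

  -- Simply typed queries and clauses in the order of their permutation.

  DisjointOutputs : Atom → Atom → Set
  DisjointOutputs a b = Disjoint (argVars output a) (argVars output b)

  -- Linearity becomes a condition on single atoms and a symmetric one on pairs, a form that
  -- survives reordering.
  linear-outputs : ∀ Q → Linear (concatMap outputs Q) →
                   All (Unique ∘ argVars output) Q × AllPairs DisjointOutputs Q
  linear-outputs []      _ = [] , []
  linear-outputs (a ∷ Q) u =
    let ua , uQ , d = Unique-++⁻ (argVars output a)
          (subst Unique (List.concatMap-++ vars (outputs a) (concatMap outputs Q)) u)
        us , ds = linear-outputs Q uQ
    in  ua ∷ us
      , All.tabulate (λ {b} b∈ (x∈a , x∈b) → d (x∈a , outputs⊆ b∈ x∈b)) ∷ ds
    where
    outputs⊆ : ∀ {Q b x} → b ∈ Q → x ∈ argVars output b → x ∈ varsˡ (concatMap outputs Q)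
    outputs⊆ b∈ x∈ =
      let t , t∈ , x∈t = find (∈-concatMap⁻ vars x∈)
      in  ∈-varsˡ⁺ (∈-concatMap⁺ outputs (Any.map (λ { refl → t∈ }) b∈)) x∈t

  NicelyOrdered-arrange : ∀ Q π → NicelyModed Q π → OutputsVariables Q →
                          NicelyOrdered (arrange Q π)
  NicelyOrdered-arrange Q π (linear , moded) variables = nicelyOrdered
    (All.map⁺ (All.tabulate λ {i} _ → let b∈ = ∈-lookup {xs = Q} i in
        All.tabulate (λ t∈ → variables _ (∈-concatMap⁺ outputs (Any.map (λ { refl → t∈ }) b∈)))
      , All.lookup (proj₁ (linear-outputs Q linear)) b∈
      -- The inequality in nice modedness is not strict, so it covers an atom's own inputs and
      -- outputs.
      , moded i i ℕ.≤-refl))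
    (AllPairs.zip (
        AllPairs.map⁺ (AllPairs.map (λ {i} {j} i<j → λ {_} → moded i j (ℕ.<⇒≤ i<j))
                                    (ranked-increasing π))
      , ↭ₛ.AllPairs-resp-↭ (setoid Atom) (λ d {_} (x∈ , y∈) → d (y∈ , x∈)) (resp₂ DisjointOutputs)
          (↭⇒↭ₛ (↭-sym (arrange-↭ Q π))) (proj₂ (linear-outputs Q linear))))

  -- The invariant of derivations. The ordered list is kept beside `Q` and tied to it by `↭`, since
  -- resolution replaces the selected atom at different places in the two lists.
  record OrderedQuery (Q : Query) : Set where
    field
      order   : Query
      order-↭ : order ↭ Q
      nice    : NicelyOrdered order
      typed   : ∀ σ → WellTypedChain (order [ σ ]ᑫ)

  orderedQuery : ∀ Q → PermutationSimplyTypedQuery Q → OrderedQuery Q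
  orderedQuery Q (π , moded , typed , variables) = record
    { order   = arrange Q π
    ; order-↭ = arrange-↭ Q π
    ; nice    = NicelyOrdered-arrange Q π moded variables
    ; typed   = λ σ → chain-arrange Q π σ (λ i → typed i σ)
    }

  WellTypedInstance : Atom → Query → Set
  WellTypedInstance h B = InputsTyped h → WellTypedChain B × (All OutputsTyped B → OutputsTyped h)

  record OrderedClause (h : Atom) (B : Query) : Set where
    field
      order   : Query
      order-↭ : order ↭ B
      nice    : NicelyOrdered order
      fresh   : ∀ {b} → b ∈ order → Disjoint (argVars input h) (argVars output b)
      typed   : ∀ σ → WellTypedInstance (h [ σ ]ᵃ) (order [ σ ]ᑫ)
      linear  : Linear (inputs h)
      flat    : ∀ i → mode (pred h) i ≡ input → Flat (lookup (args h) i)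

  orderedClause : ∀ {h B} π → SimplyTypedClause (h ⟵ B) π → InputLinearClause (h ⟵ B) →
                  OrderedClause h B
  orderedClause {h} {B} π ((moded , fresh) , (typed , out-typed) , variables , head!) linear =
    record
    { order   = arrange B π
    ; order-↭ = arrange-↭ B π
    ; nice    = NicelyOrdered-arrange B π moded variables
    ; fresh   = fresh′
    ; typed   = λ σ in! → chain-arrange B π σ (λ i → typed i σ in!)
                , λ outs! → out-typed σ in! λ j →
                    All.lookup outs! (∈-map⁺ (_[ σ ]ᵃ) (∈-map⁺ (List.lookup B) (∈-ranked π j)))
    ; linear  = linear
    ; flat    = λ i eq → proj₁ (head! i eq)
    }
    where
    fresh′ : ∀ {b} → b ∈ arrange B π → Disjoint (argVars input h) (argVars output b)
    fresh′ b∈ with j , _ , refl ← ∈-map⁻ (List.lookup B) b∈ = fresh j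

  rename : (Var ↔ Var) → Subst
  rename ρ x = var (Inverse.to ρ x)

  module _ (ρ : Var ↔ Var) where

    private
      σρ : Subst
      σρ = rename ρ

      r : ∀ {x} → Renames σρ (Inverse.from ρ) x
      r = _ , refl , Inverse.inverseʳ ρ refl

      Flat-rename : ∀ {t} → Flat t → Flat (t [ σρ ])
      Flat-rename (flat-var x)       = flat-var _
      Flat-rename (flat-fn f xs xs!) = subst (Flat ∘ fn f) (sym (map-var-[] xs))
        (flat-fn f (Vec.map (Inverse.to ρ) xs) (Uniqueᵛ.map⁺ (λ eq →
          trans (sym (Inverse.inverseʳ ρ refl)) (Inverse.inverseʳ ρ eq)) xs!))
        where
        map-var-[] : ∀ {n} (xs : Vec Var n) →
                     Vec.map var xs [ σρ ]ᵛ ≡ Vec.map var (Vec.map (Inverse.to ρ) xs)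
        map-var-[] []       = refl
        map-var-[] (x ∷ xs) = cong (_ ∷_) (map-var-[] xs)

    -- The inverse bijection is a left inverse on all variables, so the occurrence conditions
    -- transfer; the typing of the variant under `σ` is that of the clause under the renaming
    -- followed by `σ`.
    OrderedClause-rename : ∀ {h B} → OrderedClause h B → OrderedClause (h [ σρ ]ᵃ) (B [ σρ ]ᑫ)
    OrderedClause-rename {h} {B} c = record
      { order   = order [ σρ ]ᑫ
      ; order-↭ = ↭.map⁺ (_[ σρ ]ᵃ) order-↭
      ; nice    = NicelyOrdered-rename (λ _ → r) nice
      ; fresh   = fresh′
      ; typed   = λ σ → subst₂ WellTypedInstance
                    (sym ([]ᵃ-⨾ h σρ σ)) (sym ([]ᑫ-⨾ order σρ σ)) (typed (σρ ⨾ σ))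
      ; linear  = Unique-rename input h (λ _ → r) linear
      ; flat    = λ i eq → subst Flat (sym (lookup-[] (args h) σρ i)) (Flat-rename (flat i eq))
      }
      where
      open OrderedClause c

      fresh′ : ∀ {b} → b ∈ order [ σρ ]ᑫ → Disjoint (argVars input (h [ σρ ]ᵃ)) (argVars output b)
      fresh′ b∈ with b , b∈′ , refl ← ∈-map⁻ (_[ σρ ]ᵃ) b∈ =
        Disjoint-rename input h output b (λ _ → r) (λ _ → r) (fresh b∈′)


  -- Under `θ ⨾ σ` the selected atom and the head coincide. Typed inputs of the atom thus start the
  -- body, and typed outputs of the body give the outputs of the atom on which the atoms of `M`
  -- rely.
  chain-resolvent : ∀ {a h} L {B M θ} → Unifier a h θ →
    (∀ σ → WellTypedChain ((L ++ a ∷ M) [ σ ]ᑫ)) →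
    (∀ σ → WellTypedInstance (h [ σ ]ᵃ) (B [ σ ]ᑫ)) →
    ∀ σ → WellTypedChain ((L ++ B ++ M) [ θ ]ᑫ [ σ ]ᑫ)
  chain-resolvent {a} {h} L {B} {M} {θ} u goal clause σ =
    subst WellTypedChain (sym (trans ([]ᑫ-⨾ (L ++ B ++ M) θ σ)
                               (trans (List.map-++ _ L (B ++ M))
                                      (cong (L [ ζ ]ᑫ ++_) (List.map-++ _ B M)))))
      (chain-++⁺ (L [ ζ ]ᑫ) (proj₁ split) λ outs! →
        let in! , rest = proj₂ split outs!
            body! , head! = clause ζ (subst InputsTyped u′ in!)
        in  chain-++⁺ (B [ ζ ]ᑫ) body! λ bouts! → rest (subst OutputsTyped (sym u′) (head! bouts!)))
    where
    ζ : Subst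
    ζ = θ ⨾ σ

    u′ : a [ ζ ]ᵃ ≡ h [ ζ ]ᵃ
    u′ = trans (sym ([]ᵃ-⨾ a θ σ)) (trans (cong (_[ σ ]ᵃ) u) ([]ᵃ-⨾ h θ σ))

    split : WellTypedChain (L [ ζ ]ᑫ) ×
            (All OutputsTyped (L [ ζ ]ᑫ) → WellTypedChain ((a ∷ M) [ ζ ]ᑫ))
    split = chain-++⁻ (L [ ζ ]ᑫ) (subst WellTypedChain (List.map-++ _ L (a ∷ M)) (goal ζ))

  -- Typed instances of queries, and constant types.

  typed-instance : ∀ {Q} → NicelyOrdered Q → ∃ λ σ → All OutputsTyped (Q [ σ ]ᑫ)
  typed-instance {Q} (nicelyOrdered atoms pairs) =
    let bs , keys≡ , sound = go Q atoms
    in  assoc bs , sound (assoc-solves bs (subst Unique (sym keys≡) unique))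
    where
    unique : Unique (concatMap (argVars output) Q)
    unique = Unique.concat⁺ (All.map⁺ (All.map (proj₁ ∘ proj₂) atoms))
                            (AllPairs.map⁺ (AllPairs.map (λ (_ , d) {_} → d) pairs))

    witness : ∀ p i → Term
    witness p i = proj₁ (Type.non-empty (τ p i))

    match-witness : ∀ {a i} → SafeOutputs a → i ∈ positions output (pred a) →
                    Matching (lookup (args a) i) (witness (pred a) i)
    match-witness {a} {i} (vs , _) i∈
      with lookup (args a) i | All.lookup vs (∈-map⁺ (lookup (args a)) i∈)
    ... | .(var x) | is-var x = match-var x _

    -- Typing is stated for every `σ` that solves the bindings, so uniqueness of the keys is invoked
    -- once, for the complete list.
    go : ∀ Q → All SafeOutputs Q → ∃ λ bs → keys bs ≡ concatMap (argVars output) Q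
         × (∀ {σ} → Solves σ var bs → All OutputsTyped (Q [ σ ]ᑫ))
    go []      []          = [] , refl , λ _ → []
    go (a ∷ Q) (sa ∷ safe) =
      let bs , keys≡ , sound = go Q safe in
        M.bindings ++ bs
      , trans (List.map-++ proj₁ M.bindings bs) (cong₂ _++_ M.keys≡ keys≡)
      , λ {σ} s → (λ i eq → subst (τ (pred a) i ∋_)
            (sym (trans (lookup-[] (args a) σ i)
                 (trans (M.sound (All.++⁻ˡ M.bindings s) (∈-positions⁺ eq)) ([]-var _))))
            (proj₂ (Type.non-empty (τ (pred a) i))))
          ∷ sound (All.++⁻ʳ M.bindings s)
      where
      module M = Matchings (matchings {u = witness (pred a)}
        (positions output (pred a)) (match-witness {a} sa))

  -- Instantiation keeps the function symbol of a non-variable, and a symbol of arity zero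
  -- determines the term.
  constant-typed : ∀ {T t σ} → ConstantType T → NonVar t → T ∋ (t [ σ ]) → T ∋ t
  constant-typed {t = var x} constant nonvar _ = contradiction (is-var x) nonvar
  constant-typed {T} {fn f ts} {σ} constant nonvar typed
    with is-constant ar≡0 ← constant _ typed =
    subst (T ∋_) (cong (fn f) (empty ar≡0 (ts [ σ ]ᵛ) ts)) typed
    where
    empty : ∀ {n} → n ≡ 0 → (us vs : Vec Term n) → us ≡ vs
    empty refl [] [] = refl

  input-typed : ∀ {Q p ts i} → OrderedQuery Q → p · ts ∈ Q → mode p i ≡ input →
                ConstantType (τ p i) → NonVar (lookup ts i) → τ p i ∋ lookup ts i
  input-typed {Q} {p} {ts} {i} Q! a∈ eq constant nonvar =
    let σ , outs! = typed-instance nice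
        ins! = chain-inputs (typed σ) outs!
        in! = All.lookup ins! (∈-map⁺ (_[ σ ]ᵃ) (↭.∈-resp-↭ (↭-sym order-↭) a∈))
    in  constant-typed {τ p i} constant nonvar (subst (τ p i ∋_) (lookup-[] ts σ i) (in! i eq))
    where open OrderedQuery Q!

  -- Preservation of the invariant along a derivation.

  resolvent : ∀ {Q L p ts us B M θ} → Q ≡ L ++ p · ts ∷ M →
    OrderedQuery Q → OrderedClause (p · us) B →
    (SafeOutputs (p · ts) → ∀ i → mode p i ≡ input → NonVar (lookup us i) → NonVar (lookup ts i)) →
    Disjoint (varsᶜ (p · us ⟵ B)) (varsᑫ Q) → MGU (p · ts) (p · us) θ →
    OrderedQuery ((L ++ B ++ M) [ θ ]ᑫ)
  resolvent {L = L} {p} {ts} {us} {B} {M} {θ} refl Q! C! nonvar apart mgu =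
    -- The selected atom is located in the order, where its neighbours may differ from those in the
    -- query.
    go (∈-∃++ (↭.∈-resp-↭ (↭-sym Q.order-↭) (∈-++⁺ʳ L (here refl))))
    where
    module Q = OrderedQuery Q!
    module C = OrderedClause C!

    varsᑫ-↭ : ∀ {Q R x} → Q ↭ R → x ∈ varsᑫ Q → x ∈ varsᑫ R
    varsᑫ-↭ Q↭R x∈ =
      let a , a∈ , x∈a = find (∈-concatMap⁻ varsᵃ x∈)
      in  ∈-varsᑫ⁺ (↭.∈-resp-↭ Q↭R a∈) x∈a

    go : (∃ λ L′ → ∃ λ M′ → Q.order ≡ L′ ++ p · ts ∷ M′) → OrderedQuery ((L ++ B ++ M) [ θ ]ᑫ)
    go (L′ , M′ , eq) = record
      { order   = (L′ ++ C.order ++ M′) [ θ ]ᑫ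
      -- With the body moved to the front on both sides, the rests are the two lists without the
      -- selected atom, which are still permutations of each other.
      ; order-↭ = ↭.map⁺ (_[ θ ]ᵃ) (↭-trans (↭.shifts L′ C.order)
                    (↭-trans (↭.++⁺ C.order-↭ (↭.drop-mid L′ L (subst (_↭ _) eq Q.order-↭)))
                             (↭.shifts B L)))
      ; nice    = NicelyOrdered-resolvent {L = L′} {M = M′} nice C.nice C.fresh apart′
                    (inputMGU safe C.linear C.flat (nonvar safe)
                      (λ x∈h x∈a → apart′ (∈-++⁺ˡ x∈h , ∈-varsᑫ⁺ (∈-++⁺ʳ L′ (here refl)) x∈a))
                      (proj₁ mgu))
                    mgu
      ; typed   = chain-resolvent {p · ts} {p · us} L′ (proj₁ mgu)
                    (λ σ → subst (λ R → WellTypedChain (R [ σ ]ᑫ)) eq (Q.typed σ)) C.typed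
      }
      where
      nice : NicelyOrdered (L′ ++ p · ts ∷ M′)
      nice = subst NicelyOrdered eq Q.nice

      safe : SafeOutputs (p · ts)
      safe = All.lookup (NicelyOrdered.atoms nice) (∈-++⁺ʳ L′ (here refl))

      apart′ : Disjoint (varsᶜ (p · us ⟵ C.order)) (varsᑫ (L′ ++ p · ts ∷ M′))
      apart′ (x∈c , x∈q) = apart
        ( [ ∈-++⁺ˡ , ∈-++⁺ʳ (varsᵛ us) ∘ varsᑫ-↭ C.order-↭ ]′ (∈-++⁻ (varsᵛ us) x∈c)
        , varsᑫ-↭ (subst (_↭ _) eq Q.order-↭) x∈q )

  -- Safe outputs are variables, in the free positions in particular, so part (1) of input
  -- selectability applies.
  selectable-nonvar : ∀ {P} p ts → InputSelectability P → PredicateOf P p →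
                      SafeOutputs (p · ts) → Selectable P (p · ts) →
                      ∀ i → mode p i ≡ input → Bound P p i → NonVar (lookup ts i)
  selectable-nonvar p ts selectability p∈P (vs , _) selectable =
    proj₁ (selectability p p∈P ts λ i eq _ → All.lookup vs (∈-argTerms⁺ (p · ts) eq)) selectable

  OrderedQuery-step : ∀ {P Q Q′} → PermutationSimplyTyped P → InputLinear P → InputSelectability P →
    (s : Step P Q Q′) → Selectable P (Step.selected s) → OrderedQuery Q → OrderedQuery Q′
  OrderedQuery-step {P} {Q} simply (linear , _) selectability s selectable Q! =
    go selected source split source∈P variant apart mgu resolvent′ selectable
    where
    open Step s renaming (resolvent to resolvent′)

    -- The components of the step become variables here, so that the equations for the variant and
    -- the resolvent can be matched with `refl`.
    go : ∀ a c {c′ Q′} → Q ≡ before ++ a ∷ after → clauses P c → Variant c c′ →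
         Disjoint (varsᶜ c′) (varsᑫ Q) → MGU a (head c′) θ →
         Q′ ≡ (before ++ body c′ ++ after) [ θ ]ᑫ → Selectable P a → OrderedQuery Q′
    go (p · ts) (q · us ⟵ B) split c∈P (ρ , refl) apart mgu refl selectable
      with refl ← cong pred (proj₁ mgu) =
      resolvent split Q!
        (OrderedClause-rename ρ (orderedClause (proj₁ π!) (proj₂ π!) (linear _ c∈P)))
        -- Boundness speaks of the program clause and `nv` of its variant; a renaming sends
        -- variables to variables, so a non-variable in the variant comes from one in the clause.
        (λ safe i eq nv → selectable-nonvar p ts selectability (_ , c∈P , us , inj₁ refl)
          safe selectable i eq (bound-input eq _ c∈P us refl λ v →
            nv (subst IsVar (sym (lookup-[] us (rename ρ) i)) (var-renamed v))))
        apart mgu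
      where
      π! = simply _ c∈P

      var-renamed : ∀ {t} → IsVar t → IsVar (t [ rename ρ ])
      var-renamed (is-var x) = is-var _

  selected∈ : ∀ {R} (s : Selection R) → Selection.selected s ∈ R
  selected∈ s = subst (_ ∈_) (sym (Selection.split s)) (∈-++⁺ʳ (Selection.before s) (here refl))

  module _ {P Q} (simply : PermutationSimplyTyped P) (linear : InputLinear P)
           (selectability : InputSelectability P) (Q! : OrderedQuery Q)
           (D : Derivation P Q) (delay : DelayRespecting D) where
    open Derivation D

    -- Only the steps before `k` are required to exist, so the last query of a finite derivation,
    -- where an atom may be selected without a step, is included.
    OrderedQuery-derivation : ∀ k → (∀ {j} → j ℕ.< k → j ≺ len) → OrderedQuery (query k)
    OrderedQuery-derivation zero    _   = subst OrderedQuery (sym start) Q!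
    OrderedQuery-derivation (suc k) <k⇒≺ =
      OrderedQuery-step simply linear selectability (step k k≺) (delay _ (in-step k k≺))
        (OrderedQuery-derivation k (<k⇒≺ ∘ ℕ.m<n⇒m<1+n))
      where
      k≺ : k ≺ len
      k≺ = <k⇒≺ (ℕ.n<1+n k)

    OrderedQuery-selected : ∀ {a} → Selected D a → ∃ λ R → OrderedQuery R × a ∈ R
    OrderedQuery-selected (in-step k k≺) =
      query k , OrderedQuery-derivation k (≺-trans len k≺) , selected∈ (Step.selection (step k k≺))
      where
      ≺-trans : ∀ n → k ≺ n → ∀ {j} → j ℕ.< k → j ≺ n
      ≺-trans (just n) k<n j<k = ℕ.<-trans j<k k<n
      ≺-trans nothing  _   _   = tt
    OrderedQuery-selected (at-end n len≡n s _) =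
      query n , OrderedQuery-derivation n (subst (_ ≺_) (sym len≡n)) , selected∈ s

theorem6p2 : (S : Signature) → let open Syntax S in
    (τ : Typing) → let open Typed τ in
    (P : Program) → PermutationSimplyTyped P → InputLinear P → InputSelectability P →
    (Q : Query) → PermutationSimplyTypedQuery Q →
    (p : Pred) → (∀ i → mode p i ≡ input → Bound P p i × ConstantType (τ p i)) →
    (D : Derivation P Q) → DelayRespecting D →
    ∀ ts → Selected D (p · ts) → InputsTyped (p · ts)
theorem6p2 S τ P simply linear selectability Q Q-simply p inputs! D delay ts selected i eq =
  let R , R! , a∈R = OrderedQuery-selected simply linear selectability
                       (orderedQuery Q Q-simply) D delay selected
      bound , constant = inputs! i eq
  in  input-typed R! a∈R eq constant
        (selectable-nonvar p ts selectability (predicateOf bound) (safe R! a∈R)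
          (delay _ selected) i eq bound)
  where
  open Syntax S
  open Unification S
  open OrderedModes S
  open OrderedTyping S τ

  -- A bound position is witnessed by an occurrence of `p` in the program, as input selectability
  -- presupposes.
  predicateOf : ∀ {P p i} → Bound P p i → PredicateOf P p
  predicateOf (bound-input  _ c c∈P us head≡ _) = c , c∈P , us , inj₁ head≡
  predicateOf (bound-output _ c c∈P us a∈ _)    = c , c∈P , us , inj₂ a∈

  safe : ∀ {R a} → OrderedQuery R → a ∈ R → SafeOutputs a
  safe R! a∈ = All.lookup (NicelyOrdered.atoms nice) (↭.∈-resp-↭ (↭-sym order-↭) a∈)
    where open OrderedQuery R!
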